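{- Every finite simple ISK4-free graph of girth at least $5$ contains a vertex of degree at most $2$ and is $3$-colorable.
   Context: A subdivision of a graph is obtained by repeatedly replacing an edge $vw$ by a path $vuw$ through a new vertex $u$ (a graph is a subdivision of itself). An ISK4 of $G$ is an induced subgraph of $G$ that is a subdivision of $K_4$; $G$ is ISK4-free if it has none. The girth is the length of a shortest cycle (infinite if there is none). -}

module Defs where

open import Data.Nat using (ℕ; zero; suc; _≤_; _<_)
open import Data.Fin using (Fin; zero; suc; toℕ; fromℕ; inject₁)
open import Data.Fin.Patterns using (0F; 1F; 2F; 3F; 4F; 5F)
open import Data.Bool using (Bool; true; false; T?)
open import Data.List using (length; filter)
open import Data.List using () renaming (allFin to allFinL)
open import Data.Product using (Σ; ∃; _×_; _,_)
open import Data.Sum using (_⊎_)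
open import Relation.Binary.PropositionalEquality using (_≡_; _≢_)
open import Relation.Nullary using (¬_)

record Graph (n : ℕ) : Set where
  field
    E     : Fin n → Fin n → Bool
    sym   : ∀ u v → E u v ≡ E v u
    irref : ∀ v → E v v ≡ false

module _ {n : ℕ} (G : Graph n) where
  open Graph G

  Adj : Fin n → Fin n → Set
  Adj u v = E u v ≡ true

  degree : Fin n → ℕ
  degree v = length (filter (λ w → T? (E v w)) (allFinL n))

  record Cycle : Set where
    field
      m      : ℕ
      len≥3  : 3 ≤ suc m
      c      : Fin (suc m) → Fin n
      c-inj  : ∀ i j → c i ≡ c j → i ≡ j
      step   : ∀ (j : Fin m) → Adj (c (inject₁ j)) (c (suc j))
      close  : Adj (c (fromℕ m)) (c zero)

  cycleLength : Cycle → ℕ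
  cycleLength C = suc (Cycle.m C)

  -- girth ≥ g : every cycle has length ≥ g (includes infinite girth)
  GirthAtLeast : ℕ → Set
  GirthAtLeast g = (C : Cycle) → g ≤ cycleLength C

  ThreeColorable : Set
  ThreeColorable = Σ (Fin n → Fin 3) λ f → ∀ u v → Adj u v → f u ≢ f v

k4src k4tgt : Fin 6 → Fin 4
k4src 0F = 0F
k4src 1F = 0F
k4src 2F = 0F
k4src 3F = 1F
k4src 4F = 1F
k4src 5F = 2F
k4tgt 0F = 1F
k4tgt 1F = 2F
k4tgt 2F = 3F
k4tgt 3F = 2F
k4tgt 4F = 3F
k4tgt 5F = 3F

module _ {n : ℕ} (G : Graph n) where
  open Graph G

  -- An ISK4 of G, i.e. an induced subgraph of G which is a subdivision
  -- of K4, written out explicitly: four distinct branch vertices, and for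
  -- every edge e = {src e, tgt e} of K4 a path (of length ≥ 1) in G between
  -- the corresponding branch vertices, the paths being internally vertex
  -- disjoint, and the subgraph being induced: every edge of G between two
  -- vertices lying on these paths is an edge of one of the paths.
  record ISK4 : Set where
    field
      br       : Fin 4 → Fin n
      br-inj   : ∀ i j → br i ≡ br j → i ≡ j
      len      : Fin 6 → ℕ
      len≥1    : ∀ e → 1 ≤ len e
      path     : (e : Fin 6) → Fin (suc (len e)) → Fin n
      start    : ∀ e → path e zero ≡ br (k4src e)
      end      : ∀ e → path e (fromℕ (len e)) ≡ br (k4tgt e)
      path-inj : ∀ e k l → path e k ≡ path e l → k ≡ l
      path-adj : ∀ e (j : Fin (len e)) →
                   Adj G (path e (inject₁ j)) (path e (suc j))
      internal-disjoint : ∀ e f (k : Fin (suc (len e))) (l : Fin (suc (len f))) →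
                   0 < toℕ k → toℕ k < len e → path e k ≡ path f l → e ≡ f
      induced  : ∀ e f (k : Fin (suc (len e))) (l : Fin (suc (len f))) →
                   Adj G (path e k) (path f l) →
                   ∃ λ g → Σ (Fin (len g)) λ j →
                     (path e k ≡ path g (inject₁ j) × path f l ≡ path g (suc j))
                     ⊎ (path f l ≡ path g (inject₁ j) × path e k ≡ path g (suc j))

  ISK4-free : Set
  ISK4-free = ¬ ISK4

{-# OPTIONS --safe #-}

-- It suffices to show that a graph of girth at least 5 and minimum degree at least 3
-- has an ISK4; colourings then extend over deleted vertices of degree at most 2.
-- Consider nonempty connected sets D with N(D) ⊆ N(b) for some b ∉ D ("stars"), or
-- with N(D) ⊆ N(q) ∪ {c}, where c and q are joined by a path outside D ("fragments").
-- For D of minimal size, close up a shortest path through D to a hole C.  By the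
-- girth condition every other vertex of D ∪ N(D) has at most one neighbour, its foot,
-- on C.  Minimality gives two things: some component of (D ∪ N(D)) \ C has at least
-- three feet, and from an unattached vertex one can walk through unattached vertices
-- to a foot different from any prescribed b.  Hence there are three attached vertices
-- with distinct feet, joined through unattached vertices only, and a shortest tripod
-- joining them forms an ISK4 together with C.
-- The goal of all this is ⊥, so excluded middle is available in the form em.

module Submission where

open import Defs
open import Data.Nat using (ℕ; zero; suc; _≤_; _<_; _+_; _∸_; z≤n; s≤s; _≤?_; _<?_)
open import Data.Nat.Properties
open import Data.Nat.Induction using (<-rec)
open import Data.Nat.Tactic.RingSolver using (solve-∀)
open import Data.Fin using (Fin; zero; suc; toℕ; fromℕ<; inject₁; punchIn; punchOut)
import Data.Fin.Properties as Fin
open import Data.Fin.Patterns using (0F; 1F; 2F; 3F; 4F; 5F)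
open import Data.Bool using (true; T; T?)
import Data.Bool.Properties as Bool
open import Data.List using (List; []; _∷_; length; filter; allFin)
open import Data.List.Properties using (filter-notAll)
open import Data.List.Membership.Propositional using (_∈_; lose)
open import Data.List.Membership.Propositional.Properties using (∈-filter⁺; ∈-filter⁻; ∈-allFin)
open import Data.List.Relation.Unary.Any using (here; there)
open import Data.List.Relation.Unary.All using ([]; _∷_)
open import Data.List.Relation.Unary.Unique.Propositional using (Unique)
open import Data.List.Relation.Unary.AllPairs using ([]; _∷_)
open import Data.List.Relation.Unary.Unique.Propositional.Properties using (allFin⁺; filter⁺)
open import Data.Product using (Σ; ∃; _×_; _,_; proj₁; proj₂)
open import Data.Sum using (_⊎_; inj₁; inj₂)
open import Data.Unit using (⊤; tt)
open import Data.Empty using (⊥; ⊥-elim)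
open import Function using (_∘_; id)
open import Relation.Nullary using (¬_; Dec; yes; no; contradiction)
open import Relation.Nullary.Decidable using (decidable-stable; ¬?; _×-dec_)
open import Relation.Binary.PropositionalEquality using (_≡_; _≢_; refl; sym; trans; cong; cong₂; subst; subst₂)
open import Relation.Binary.Definitions using (tri<; tri≈; tri>)

-- Stars alone do not reproduce themselves. If the feet of a component are confined to two hole
-- vertices that are neither equal nor adjacent, its boundary need not lie in the neighbourhood of
-- one vertex. Fragments absorb this case: one foot becomes the new `c`, the other becomes `S`, and
-- the hole between them supplies the outside path. That path has to be carried along, because it is
-- what closes a walk through `D` to a cycle; the conditions on `O` make this cycle induced.
-- Conversely, a star with two boundary vertices is a fragment of the same size. Hence one induction
-- serves both: fragments of size k+1 rest on stars and fragments of size k, stars of size k+1 on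
-- fragments of size k+1 and stars of size k. In passing to a component off the hole, the decrease
-- comes from the second hole vertex `d₁`: it lies in `D`, but in no such component.

em : (P : Set) → (Dec P → ⊥) → ⊥
em P k = k (no (k ∘ yes))

-- Strong induction on the witness: it is minimal, or a smaller one takes over. This is how shortest
-- walks and shortest tripods are chosen.
least : (P : ℕ → Set) → ∀ m → P m → (∀ k → P k → (∀ j → P j → k ≤ j) → ⊥) → ⊥
least P = <-rec (λ m → P m → (∀ k → P k → (∀ j → P j → k ≤ j) → ⊥) → ⊥) λ m rec pm k →
  em (∃ λ j → j < m × P j) λ where
    (yes (j , j<m , pj)) → rec j<m pj k
    (no none) → k m pm λ j pj → ≮⇒≥ λ j<m → none (j , j<m , pj)

splice-< : ∀ {i j l} → i < j → j ≤ l → i + (l ∸ j) < l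
splice-< {i} {j} {l} i<j j≤l = ≤-trans (+-monoˡ-< (l ∸ j) i<j) (≤-reflexive (m+[n∸m]≡n j≤l))

x+[y+z]≡y+[x+z] : ∀ x y z → x + (y + z) ≡ y + (x + z)
x+[y+z]≡y+[x+z] = solve-∀

-- Walks and geodesics.

module Walks {n : ℕ} (G : Graph n) where
  open Graph G using (E) renaming (sym to E-sym; irref to E-irref)

  V : Set
  V = Fin n

  infix 4 _~_
  _~_ : V → V → Set
  u ~ v = Adj G u v

  ~-sym : ∀ {u v} → u ~ v → v ~ u
  ~-sym {u} {v} e = trans (E-sym v u) e

  ~-irrefl : ∀ {v} → ¬ v ~ v
  ~-irrefl {v} e with trans (sym e) (E-irref v)
  ... | ()

  ~⇒≢ : ∀ {u v} → u ~ v → u ≢ v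
  ~⇒≢ e refl = ~-irrefl e

  _~?_ : ∀ u v → Dec (u ~ v)
  u ~? v = E u v Bool.≟ true

  ~-stable : ∀ {u v} → ¬ ¬ u ~ v → u ~ v
  ~-stable {u} {v} = decidable-stable (u ~? v)

  ≡-stable : ∀ {u v : V} → ¬ u ≢ v → u ≡ v
  ≡-stable {u} {v} = decidable-stable (u Fin.≟ v)

  data Walk (X : V → Set) : V → V → ℕ → Set where
    stop : ∀ {u} → X u → Walk X u u 0
    step : ∀ {u w v l} → X u → u ~ w → Walk X w v l → Walk X u v (suc l)

  -- Totalised by staying at the endpoint beyond the length, so that positions are plain numbers and
  -- bounds appear only where they matter.
  at : ∀ {X u v l} → Walk X u v l → ℕ → V
  at {u = u} (stop _) _ = u
  at {u = u} (step _ _ _) zero = u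
  at (step _ _ p) (suc i) = at p i

  module _ {X : V → Set} where

    first : ∀ {u v l} → Walk X u v l → X u
    first (stop x) = x
    first (step x _ _) = x

    at-zero : ∀ {u v l} (p : Walk X u v l) → at p 0 ≡ u
    at-zero (stop _) = refl
    at-zero (step _ _ _) = refl

    at-last : ∀ {u v l} (p : Walk X u v l) → at p l ≡ v
    at-last (stop _) = refl
    at-last (step _ _ p) = at-last p

    at-∈ : ∀ {u v l} (p : Walk X u v l) i → X (at p i)
    at-∈ (stop x) _ = x
    at-∈ (step x _ _) zero = x
    at-∈ (step _ _ p) (suc i) = at-∈ p i

    at-~ : ∀ {u v l} (p : Walk X u v l) {i} → i < l → at p i ~ at p (suc i)
    at-~ (step _ e p) {zero} _ = subst (_ ~_) (sym (at-zero p)) e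
    at-~ (step _ e p) {suc i} (s≤s i<l) = at-~ p i<l

    last : ∀ {u v l} → Walk X u v l → X v
    last (stop x) = x
    last (step _ _ p) = last p

    infixr 5 _⊕_
    _⊕_ : ∀ {u v w l m} → Walk X u v l → Walk X v w m → Walk X u w (l + m)
    stop _ ⊕ q = q
    step x e p ⊕ q = step x e (p ⊕ q)

    at-⊕ˡ : ∀ {u v w l m} (p : Walk X u v l) (q : Walk X v w m) {i} → i ≤ l → at (p ⊕ q) i ≡ at p i
    at-⊕ˡ (stop _) q {zero} _ = at-zero q
    at-⊕ˡ (step _ _ p) q {zero} _ = refl
    at-⊕ˡ (step _ _ p) q {suc i} (s≤s i≤l) = at-⊕ˡ p q i≤l

    at-⊕ʳ : ∀ {u v w l m} (p : Walk X u v l) (q : Walk X v w m) i → at (p ⊕ q) (l + i) ≡ at q i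
    at-⊕ʳ (stop _) q i = refl
    at-⊕ʳ (step _ _ p) q i = at-⊕ʳ p q i

    snoc : ∀ {u v w l} → Walk X u v l → v ~ w → X w → Walk X u w (suc l)
    snoc (stop x) e y = step x e (stop y)
    snoc (step x e′ p) e y = step x e′ (snoc p e y)

    at-snoc : ∀ {u v w l} (p : Walk X u v l) (e : v ~ w) (y : X w) {i} → i ≤ l → at (snoc p e y) i ≡ at p i
    at-snoc (stop x) e y {zero} _ = refl
    at-snoc (step x e′ p) e y {zero} _ = refl
    at-snoc (step x e′ p) e y {suc i} (s≤s i≤l) = at-snoc p e y i≤l

    reverse : ∀ {u v l} → Walk X u v l → Walk X v u l
    reverse (stop x) = stop x
    reverse (step x e p) = snoc (reverse p) (~-sym e) x

    take : ∀ {u v l} (p : Walk X u v l) {i} → i ≤ l → Walk X u (at p i) i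
    take p {zero} _ = subst (λ w → Walk X _ w 0) (sym (at-zero p)) (stop (first p))
    take (step x e p) {suc i} (s≤s i≤l) = step x e (take p i≤l)

    drop : ∀ {u v l} (p : Walk X u v l) {i} → i ≤ l → Walk X (at p i) v (l ∸ i)
    drop p {zero} _ = subst (λ w → Walk X w _ _) (sym (at-zero p)) p
    drop (step _ _ p) {suc i} (s≤s i≤l) = drop p i≤l

    Geodesic : V → V → ℕ → Set
    Geodesic u v l = ∀ {m} → Walk X u v m → l ≤ m

    module _ {u v l} (p : Walk X u v l) (geo : Geodesic u v l) {i j : ℕ} (i<j : i < j) (j≤l : j ≤ l) where

      private
        i≤l : i ≤ l
        i≤l = ≤-trans (<⇒≤ i<j) j≤l

      geodesic-injective : at p i ≢ at p j
      geodesic-injective eq = <⇒≱ (splice-< i<j j≤l)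
        (geo (take p i≤l ⊕ subst (λ w → Walk X w v (l ∸ j)) (sym eq) (drop p j≤l)))

      -- A chord that skips a vertex would be a shortcut.
      geodesic-induced : at p i ~ at p j → j ≡ suc i
      geodesic-induced e with m≤n⇒m<n∨m≡n i<j
      ... | inj₂ eq = sym eq
      ... | inj₁ si<j = contradiction
        (geo (take p i≤l ⊕ step (at-∈ p i) e (drop p j≤l)))
        (<⇒≱ (subst (_< l) (sym (+-suc i (l ∸ j))) (splice-< si<j j≤l)))

  widen : ∀ {X Y : V → Set} {u v l} → (∀ {w} → X w → Y w) → Walk X u v l → Walk Y u v l
  widen f (stop x) = stop (f x)
  widen f (step x e p) = step (f x) e (widen f p)

  at-widen : ∀ {X Y : V → Set} {u v l} (g : ∀ {w} → X w → Y w) (p : Walk X u v l) i → at (widen g p) i ≡ at p i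
  at-widen g (stop _) i = refl
  at-widen g (step _ _ p) zero = refl
  at-widen g (step _ _ p) (suc i) = at-widen g p i

  -- Holes and their rotations.

  record Hole : Set where
    field
      N      : ℕ
      2≤N    : 2 ≤ N
      f      : ℕ → V
      closed : f N ≡ f 0
      f-~    : ∀ {t} → t < N → f t ~ f (suc t)
      f-inj  : ∀ {s t} → s < t → t < N → f s ≢ f t
      -- The second alternative is the closing edge, from the last position back to `f N`, which is
      -- `f 0`.
      f-ind  : ∀ {s t} → s < t → t < N → f s ~ f t → t ≡ suc s ⊎ (s ≡ 0 × suc t ≡ N)

    On : V → Set
    On v = ∃ λ t → t < N × f t ≡ v

    f-injective : ∀ {s t} → s < N → t < N → f s ≡ f t → s ≡ t
    f-injective {s} {t} s<N t<N eq with <-cmp s t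
    ... | tri< s<t _ _ = contradiction eq (f-inj s<t t<N)
    ... | tri≈ _ s≡t _ = s≡t
    ... | tri> _ _ t<s = contradiction (sym eq) (f-inj t<s s<N)

  module _ (H : Hole) where
    open Hole H

    private
      -- A shift by one; the value `f 1` at `N` makes the shifted sequence close up again.
      g : ℕ → V
      g t with t <? N
      ... | yes _ = f (suc t)
      ... | no _ = f 1

      g-< : ∀ {t} → t < N → g t ≡ f (suc t)
      g-< {t} t<N with t <? N
      ... | yes _ = refl
      ... | no t≮N = contradiction t<N t≮N

      g-N : g N ≡ f 1
      g-N with N <? N
      ... | yes N<N = contradiction N<N (<-irrefl refl)
      ... | no _ = refl

      0<N : 0 < N
      0<N = ≤-trans (s≤s z≤n) 2≤N

      g-last : ∀ {t} → suc t ≡ N → g t ≡ f 0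
      g-last eq = trans (g-< (≤-reflexive eq)) (trans (cong f eq) closed)

      g-~ : ∀ {t} → t < N → g t ~ g (suc t)
      g-~ {t} t<N with m≤n⇒m<n∨m≡n t<N
      ... | inj₁ st<N = subst₂ _~_ (sym (g-< t<N)) (sym (g-< st<N)) (f-~ st<N)
      ... | inj₂ refl = subst₂ _~_ (sym (g-last refl)) (sym g-N) (f-~ 0<N)

      g-inj : ∀ {s t} → s < t → t < N → g s ≢ g t
      g-inj {s} {t} s<t t<N eq with m≤n⇒m<n∨m≡n t<N
      ... | inj₁ st<N = f-inj (s≤s s<t) st<N (trans (sym (g-< (<-trans s<t t<N))) (trans eq (g-< t<N)))
      ... | inj₂ st≡N = f-inj (s≤s z≤n) (≤-trans (s≤s s<t) t<N)
        (sym (trans (sym (g-< (<-trans s<t t<N))) (trans eq (g-last st≡N))))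

      g-ind : ∀ {s t} → s < t → t < N → g s ~ g t → t ≡ suc s ⊎ (s ≡ 0 × suc t ≡ N)
      g-ind {s} {t} s<t t<N e with m≤n⇒m<n∨m≡n t<N
      ... | inj₁ st<N with f-ind (s≤s s<t) st<N (subst₂ _~_ (g-< (<-trans s<t t<N)) (g-< t<N) e)
      ...   | inj₁ eq = inj₁ (suc-injective eq)
      g-ind {s} {t} s<t t<N e | inj₂ st≡N
        with f-ind (s≤s z≤n) (≤-trans (s≤s s<t) t<N)
               (~-sym (subst₂ _~_ (g-< (<-trans s<t t<N)) (g-last st≡N) e))
      ... | inj₁ eq = inj₂ (suc-injective eq , st≡N)
      ... | inj₂ (_ , eq) = inj₁ (suc-injective (trans st≡N (sym eq)))

    rotate₁ : Hole
    rotate₁ = record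
      { N = N ; 2≤N = 2≤N ; f = g
      ; closed = trans g-N (sym (g-< 0<N))
      ; f-~ = g-~ ; f-inj = g-inj ; f-ind = g-ind }

    f-rotate₁ : ∀ {t} → t < N → Hole.f rotate₁ t ≡ f (suc t)
    f-rotate₁ = g-<

    On-rotate₁ : ∀ {v} → On v → Hole.On rotate₁ v
    On-rotate₁ (suc t , st<N , eq) = t , <-trans (n<1+n t) st<N , trans (g-< (<-trans (n<1+n t) st<N)) eq
    On-rotate₁ (zero , _ , eq) = last-index N refl
      where
      last-index : ∀ M → M ≡ N → ∃ λ t → t < N × g t ≡ _
      last-index zero M≡N = contradiction (subst (0 <_) (sym M≡N) 0<N) λ ()
      last-index (suc t) M≡N = t , ≤-reflexive M≡N , trans (g-last M≡N) eq

    On-rotate₁⁻ : ∀ {v} → Hole.On rotate₁ v → On v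
    On-rotate₁⁻ (t , t<N , eq) with m≤n⇒m<n∨m≡n t<N
    ... | inj₁ st<N = suc t , st<N , trans (sym (g-< t<N)) eq
    ... | inj₂ st≡N = 0 , 0<N , trans (sym (g-last st≡N)) eq

  -- Bringing one foot to position 0 turns the cyclic order of three feet into a linear one,
  -- `0 < j < k`.
  rotate : ∀ i (H : Hole) → i < Hole.N H →
    Σ Hole λ H′ → Hole.f H′ 0 ≡ Hole.f H i
                × (∀ {v} → Hole.On H v → Hole.On H′ v) × (∀ {v} → Hole.On H′ v → Hole.On H v)
  rotate zero H _ = H , refl , id , id
  rotate (suc i) H si<N =
    let i<N = <-trans (n<1+n i) si<N
        (H′ , eq , to , from) = rotate i (rotate₁ H) i<N
    in H′ , trans eq (f-rotate₁ H i<N) , to ∘ On-rotate₁ H , On-rotate₁⁻ H ∘ from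

  -- A hole with three legs as a subdivision of `K4`.

  feet : ℕ → ℕ → Fin 3 → ℕ
  feet j k 0F = 0
  feet j k 1F = j
  feet j k 2F = k

  module Spider (H : Hole) (j k : ℕ) (0<j : 0 < j) (j<k : j < k) (k<N : k < Hole.N H)
    (y : V) (r : Fin 3 → ℕ) (leg : Fin 3 → ℕ → V) where

    open Hole H

    foot : Fin 3 → ℕ
    foot = feet j k

    private
      j<N : j < N
      j<N = <-trans j<k k<N

      0<N : 0 < N
      0<N = <-trans 0<j j<N

      foot<N : ∀ i → foot i < N
      foot<N 0F = 0<N
      foot<N 1F = j<N
      foot<N 2F = k<N

    record Induced : Set where
      field
        leg-start : ∀ i → leg i 0 ≡ y
        leg-end   : ∀ i → leg i (suc (r i)) ≡ f (foot i)
        leg-~     : ∀ i {t} → t < suc (r i) → leg i t ~ leg i (suc t)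
        leg-off   : ∀ i {t} → t ≤ r i → ¬ On (leg i t)
        leg-inj   : ∀ i {s t} → s < t → t ≤ r i → leg i s ≢ leg i t
        leg-ind   : ∀ i {s t} → s < t → t ≤ r i → leg i s ~ leg i t → t ≡ suc s
        -- `i′` may differ from `i`: if the centre `y` is itself attached to the hole, it is the end
        -- of one leg and the start of all three.
        leg-foot  : ∀ i {t v} → t ≤ r i → On v → leg i t ~ v → ∃ λ i′ → leg i t ≡ leg i′ (r i′) × v ≡ f (foot i′)
        apart     : ∀ i i′ → i ≢ i′ → ∀ {s t} → 0 < s → s ≤ r i → 0 < t → t ≤ r i′ →
                      leg i s ≢ leg i′ t × ¬ leg i s ~ leg i′ t

    lo hi : Fin 3 → ℕ
    lo = foot
    hi 0F = j
    hi 1F = k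
    hi 2F = N

    -- The last arc is traversed backwards, from f N = f 0 to f k, because k4src
    -- and k4tgt orient the three rim edges of K4 acyclically.
    arc : Fin 3 → ℕ → V
    arc 0F t = f t
    arc 1F t = f (j + t)
    arc 2F t = f (N ∸ t)

    arc-length : Fin 3 → ℕ
    arc-length 0F = j
    arc-length 1F = k ∸ j
    arc-length 2F = N ∸ k

    -- Turns questions about arcs into questions about intervals of positions. The third arc is read
    -- as running between `k` and `N`, so that wrapping around concerns the position `N` only.
    arc-index : ∀ a {t} → t ≤ arc-length a → ∃ λ s → lo a ≤ s × s ≤ hi a × arc a t ≡ f s
                  × (0 < t → t < arc-length a → lo a < s × s < hi a)
    arc-index 0F {t} t≤ = t , z≤n , t≤ , refl , _,_
    arc-index 1F {t} t≤ = j + t , m≤m+n j t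
      , ≤-trans (+-monoʳ-≤ j t≤) (≤-reflexive (m+[n∸m]≡n (<⇒≤ j<k))) , refl
      , λ 0<t t< → subst (_≤ j + t) (+-comm j 1) (+-monoʳ-≤ j 0<t)
                 , ≤-trans (+-monoʳ-< j t<) (≤-reflexive (m+[n∸m]≡n (<⇒≤ j<k)))
    arc-index 2F {t} t≤ = N ∸ t
      , ≤-trans (≤-reflexive (sym (m∸[m∸n]≡n (<⇒≤ k<N)))) (∸-monoʳ-≤ N t≤) , m∸n≤m N t , refl
      , λ 0<t t< → ≤-trans (≤-reflexive (cong suc (sym (m∸[m∸n]≡n (<⇒≤ k<N))))) (∸-monoʳ-< t< (m∸n≤m N k))
                 , ∸-monoʳ-< 0<t (≤-trans t≤ (m∸n≤m N k))

    ArcEdge : ℕ → Fin 3 → Set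
    ArcEdge s a = ∃ λ t → t < arc-length a ×
      ((f s ≡ arc a t × f (suc s) ≡ arc a (suc t)) ⊎ (f (suc s) ≡ arc a t × f s ≡ arc a (suc t)))

    arc-edge : ∀ {s} → s < N → ∃ (ArcEdge s)
    arc-edge {s} s<N with s <? j
    ... | yes s<j = 0F , s , s<j , inj₁ (refl , refl)
    ... | no s≮j with s <? k
    ...   | yes s<k = 1F , s ∸ j , ∸-monoˡ-< s<k j≤s , inj₁ (cong f (sym (m+[n∸m]≡n j≤s))
                    , cong f (sym (trans (+-suc j (s ∸ j)) (cong suc (m+[n∸m]≡n j≤s)))))
      where j≤s = ≮⇒≥ s≮j
    ...   | no s≮k = 2F , N ∸ suc s , ∸-monoʳ-< (s≤s (≮⇒≥ s≮k)) s<N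
                    , inj₂ (cong f (sym (m∸[m∸n]≡n s<N))
                    , cong f (sym (trans (cong (N ∸_) (sym (+-∸-assoc 1 s<N))) (m∸[m∸n]≡n (<⇒≤ s<N)))))

    Index : Set
    Index = Fin 3 ⊎ Fin 3

    -- The edges of `K4` at branch vertex 0, the centre, are the legs. Edge 4 joins feet 0 and 2 and
    -- is therefore the arc that ends at position `N`; edge 5 joins feet 1 and 2.
    kind : Fin 6 → Index
    kind 0F = inj₁ 0F
    kind 1F = inj₁ 1F
    kind 2F = inj₁ 2F
    kind 3F = inj₂ 0F
    kind 4F = inj₂ 2F
    kind 5F = inj₂ 1F

    unkind : Index → Fin 6
    unkind (inj₁ 0F) = 0F
    unkind (inj₁ 1F) = 1F
    unkind (inj₁ 2F) = 2F
    unkind (inj₂ 0F) = 3F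
    unkind (inj₂ 1F) = 5F
    unkind (inj₂ 2F) = 4F

    unkind-kind : ∀ e → unkind (kind e) ≡ e
    unkind-kind 0F = refl
    unkind-kind 1F = refl
    unkind-kind 2F = refl
    unkind-kind 3F = refl
    unkind-kind 4F = refl
    unkind-kind 5F = refl

    kind-unkind : ∀ x → kind (unkind x) ≡ x
    kind-unkind (inj₁ 0F) = refl
    kind-unkind (inj₁ 1F) = refl
    kind-unkind (inj₁ 2F) = refl
    kind-unkind (inj₂ 0F) = refl
    kind-unkind (inj₂ 1F) = refl
    kind-unkind (inj₂ 2F) = refl

    kind-injective : ∀ {e e′} → kind e ≡ kind e′ → e ≡ e′
    kind-injective {e} {e′} eq = trans (sym (unkind-kind e)) (trans (cong unkind eq) (unkind-kind e′))

    size : Index → ℕ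
    size (inj₁ i) = suc (r i)
    size (inj₂ a) = arc-length a

    point : Index → ℕ → V
    point (inj₁ i) = leg i
    point (inj₂ a) = arc a

    size≥1 : ∀ x → 1 ≤ size x
    size≥1 (inj₁ i) = s≤s z≤n
    size≥1 (inj₂ 0F) = 0<j
    size≥1 (inj₂ 1F) = m<n⇒0<n∸m j<k
    size≥1 (inj₂ 2F) = m<n⇒0<n∸m k<N

    module _ (ind : Induced) where
      open Induced ind

      branch : Fin 4 → V
      branch zero = y
      branch (suc i) = f (foot i)

      y-off : ¬ On y
      y-off = subst (¬_ ∘ On) (leg-start 0F) (leg-off 0F z≤n)

      foot-injective : ∀ i i′ → foot i ≡ foot i′ → i ≡ i′
      foot-injective 0F 0F _ = refl
      foot-injective 1F 1F _ = refl
      foot-injective 2F 2F _ = refl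
      foot-injective 0F 1F eq = contradiction eq (<⇒≢ 0<j)
      foot-injective 0F 2F eq = contradiction eq (<⇒≢ (<-trans 0<j j<k))
      foot-injective 1F 0F eq = contradiction (sym eq) (<⇒≢ 0<j)
      foot-injective 1F 2F eq = contradiction eq (<⇒≢ j<k)
      foot-injective 2F 0F eq = contradiction (sym eq) (<⇒≢ (<-trans 0<j j<k))
      foot-injective 2F 1F eq = contradiction (sym eq) (<⇒≢ j<k)

      branch-injective : ∀ i i′ → branch i ≡ branch i′ → i ≡ i′
      branch-injective zero zero _ = refl
      branch-injective zero (suc i) eq = contradiction (foot i , foot<N i , sym eq) y-off
      branch-injective (suc i) zero eq = contradiction (foot i , foot<N i , eq) y-off
      branch-injective (suc i) (suc i′) eq = cong suc (foot-injective i i′ (f-injective (foot<N i) (foot<N i′) eq))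

      point-start : ∀ e → point (kind e) 0 ≡ branch (k4src e)
      point-start 0F = leg-start 0F
      point-start 1F = leg-start 1F
      point-start 2F = leg-start 2F
      point-start 3F = refl
      point-start 4F = closed
      point-start 5F = cong f (+-identityʳ j)

      point-end : ∀ e → point (kind e) (size (kind e)) ≡ branch (k4tgt e)
      point-end 0F = leg-end 0F
      point-end 1F = leg-end 1F
      point-end 2F = leg-end 2F
      point-end 3F = refl
      point-end 4F = cong f (m∸[m∸n]≡n (<⇒≤ k<N))
      point-end 5F = cong f (m+[n∸m]≡n (<⇒≤ j<k))

      -- The foot at the end of a leg counts as a rim vertex. The centre has a representation on
      -- each of the three legs, which `edge` has to reconcile.
      data Place (v : V) : Set where
        on  : ∀ {s} → s < N → v ≡ f s → Place v
        off : ∀ i {t} → t ≤ r i → v ≡ leg i t → Place v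

      On≤ : ∀ {s} → s ≤ N → On (f s)
      On≤ {s} s≤N with m≤n⇒m<n∨m≡n s≤N
      ... | inj₁ s<N = s , s<N , refl
      ... | inj₂ refl = 0 , 0<N , sym closed

      hi≤N : ∀ a → hi a ≤ N
      hi≤N 0F = <⇒≤ j<N
      hi≤N 1F = <⇒≤ k<N
      hi≤N 2F = ≤-refl

      arc-On : ∀ a {t} → t ≤ arc-length a → On (arc a t)
      arc-On a t≤ with arc-index a t≤
      ... | s , _ , s≤hi , eq , _ = subst On (sym eq) (On≤ (≤-trans s≤hi (hi≤N a)))

      place : ∀ x {t} → t ≤ size x → Place (point x t)
      place (inj₁ i) t≤ with m≤n⇒m<n∨m≡n t≤
      ... | inj₁ (s≤s t≤r) = off i t≤r refl
      ... | inj₂ refl = on (foot<N i) (leg-end i)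
      place (inj₂ a) t≤ with arc-On a t≤
      ... | s , s<N , eq = on s<N (sym eq)

      Edge : V → V → Set
      Edge u v = ∃ λ x → ∃ λ t → t < size x ×
        ((u ≡ point x t × v ≡ point x (suc t)) ⊎ (v ≡ point x t × u ≡ point x (suc t)))

      Edge-sym : ∀ {u v} → Edge u v → Edge v u
      Edge-sym (x , t , t< , inj₁ eqs) = x , t , t< , inj₂ eqs
      Edge-sym (x , t , t< , inj₂ eqs) = x , t , t< , inj₁ eqs

      rim-edge : ∀ {s} → s < N → Edge (f s) (f (suc s))
      rim-edge s<N with arc-edge s<N
      ... | a , t , t< , eqs = inj₂ a , t , t< , eqs

      rim-induced : ∀ {s t} → s < t → t < N → f s ~ f t → Edge (f s) (f t)
      rim-induced s<t t<N e with f-ind s<t t<N e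
      ... | inj₁ refl = rim-edge (<-trans s<t t<N)
      ... | inj₂ (refl , refl) = Edge-sym (subst (Edge _) closed (rim-edge t<N))

      leg-edge : ∀ i {s t} → s < t → t ≤ r i → leg i s ~ leg i t → Edge (leg i s) (leg i t)
      leg-edge i {s} s<t t≤ e with leg-ind i s<t t≤ e
      ... | refl = inj₁ i , s , ≤-trans s<t (≤-trans t≤ (n≤1+n _)) , inj₁ (refl , refl)

      leg-induced : ∀ i {s t} → s ≤ r i → t ≤ r i → leg i s ~ leg i t → Edge (leg i s) (leg i t)
      leg-induced i {s} {t} s≤ t≤ e with <-cmp s t
      ... | tri< s<t _ _ = leg-edge i s<t t≤ e
      ... | tri≈ _ refl _ = contradiction e ~-irrefl
      ... | tri> _ _ t<s = Edge-sym (leg-edge i t<s s≤ (~-sym e))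

      same-start : ∀ i i′ → leg i 0 ≡ leg i′ 0
      same-start i i′ = trans (leg-start i) (sym (leg-start i′))

      -- Rim against rim is `f-ind`, rim against leg is `leg-foot`, a leg against itself is
      -- `leg-ind`. For different legs, a centre on one side is reinterpreted on the other leg, and
      -- two later points are excluded by `apart`.
      edge : ∀ {u v} → Place u → Place v → u ~ v → Edge u v
      edge (on {s} s<N refl) (on {t} t<N refl) e with <-cmp s t
      ... | tri< s<t _ _ = rim-induced s<t t<N e
      ... | tri≈ _ refl _ = contradiction e ~-irrefl
      ... | tri> _ _ t<s = Edge-sym (rim-induced t<s s<N (~-sym e))
      edge (on s<N refl) (off i t≤ refl) e with leg-foot i t≤ (_ , s<N , refl) (~-sym e)
      ... | i′ , eq , eq′ = inj₁ i′ , r i′ , ≤-refl , inj₂ (eq , trans eq′ (sym (leg-end i′)))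
      edge (off i t≤ refl) (on s<N refl) e with leg-foot i t≤ (_ , s<N , refl) e
      ... | i′ , eq , eq′ = inj₁ i′ , r i′ , ≤-refl , inj₁ (eq , trans eq′ (sym (leg-end i′)))
      edge (off i {s} s≤ refl) (off i′ {t} t≤ refl) e with i Fin.≟ i′
      ... | yes refl = leg-induced i s≤ t≤ e
      edge (off i {zero} s≤ refl) (off i′ {t} t≤ refl) e | no _ =
        subst (λ u → Edge u (leg i′ t)) (same-start i′ i)
          (leg-induced i′ z≤n t≤ (subst (_~ leg i′ t) (same-start i i′) e))
      edge (off i {s@(suc _)} s≤ refl) (off i′ {zero} t≤ refl) e | no _ =
        subst (Edge (leg i s)) (same-start i i′)
          (leg-induced i s≤ z≤n (subst (leg i s ~_) (same-start i′ i) e))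
      edge (off i {suc _} s≤ refl) (off i′ {suc _} t≤ refl) e | no i≢i′ =
        contradiction e (proj₂ (apart i i′ i≢i′ (s≤s z≤n) s≤ (s≤s z≤n) t≤))

      arcs-apart : ∀ a b {s} → lo a < s → s < hi a → lo b ≤ s → s ≤ hi b → a ≡ b
      arcs-apart 0F 0F _ _ _ _ = refl
      arcs-apart 1F 1F _ _ _ _ = refl
      arcs-apart 2F 2F _ _ _ _ = refl
      arcs-apart 0F 1F _ s<j j≤s _ = contradiction s<j (≤⇒≯ j≤s)
      arcs-apart 0F 2F _ s<j k≤s _ = contradiction (<-trans s<j j<k) (≤⇒≯ k≤s)
      arcs-apart 1F 0F j<s _ _ s≤j = contradiction j<s (≤⇒≯ s≤j)
      arcs-apart 1F 2F _ s<k k≤s _ = contradiction s<k (≤⇒≯ k≤s)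
      arcs-apart 2F 0F k<s _ _ s≤j = contradiction (<-trans j<k k<s) (≤⇒≯ s≤j)
      arcs-apart 2F 1F k<s _ _ s≤k = contradiction k<s (≤⇒≯ s≤k)

      foot-not-interior : ∀ a i → lo a < foot i → foot i < hi a → ⊥
      foot-not-interior 0F 1F _ p = <-irrefl refl p
      foot-not-interior 0F 2F _ p = <-asym j<k p
      foot-not-interior 1F 1F p _ = <-irrefl refl p
      foot-not-interior 1F 2F _ p = <-irrefl refl p
      foot-not-interior 2F 1F p _ = <-asym j<k p
      foot-not-interior 2F 2F p _ = <-irrefl refl p

      -- For arcs, the common vertex is compared by position: inside an arc there is no foot and no
      -- point of another arc, and position `N` stands for 0, which is interior to no arc.
      disjoint : ∀ x z {s t} → 0 < s → s < size x → t ≤ size z → point x s ≡ point z t → x ≡ z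
      disjoint (inj₁ i) (inj₁ i′) {s} {t} 0<s (s≤s s≤) t≤ eq with i Fin.≟ i′ | m≤n⇒m<n∨m≡n t≤
      ... | yes refl | _ = refl
      ... | no _ | inj₂ refl = contradiction (foot i′ , foot<N i′ , sym (trans eq (leg-end i′))) (leg-off i s≤)
      disjoint (inj₁ i) (inj₁ i′) {s} {zero} 0<s (s≤s s≤) t≤ eq | no _ | inj₁ _ =
        contradiction (sym (trans eq (same-start i′ i))) (leg-inj i 0<s s≤)
      disjoint (inj₁ i) (inj₁ i′) {s} {suc _} 0<s (s≤s s≤) t≤ eq | no i≢i′ | inj₁ (s≤s t≤r) =
        contradiction eq (proj₁ (apart i i′ i≢i′ 0<s s≤ (s≤s z≤n) t≤r))
      disjoint (inj₁ i) (inj₂ a) 0<s (s≤s s≤) t≤ eq =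
        contradiction (subst On (sym eq) (arc-On a t≤)) (leg-off i s≤)
      disjoint (inj₂ a) z {s} 0<s s< t≤ eq with arc-index a (<⇒≤ s<)
      ... | u , _ , _ , eq-u , interior = on-arc z t≤ (trans (sym eq-u) eq) (interior 0<s s<)
        where
        on-arc : ∀ z {t} → t ≤ size z → f u ≡ point z t → lo a < u × u < hi a → inj₂ a ≡ z
        on-arc (inj₁ i) t≤ eq (lo< , <hi) with m≤n⇒m<n∨m≡n t≤
        ... | inj₁ (s≤s t≤r) = contradiction (u , ≤-trans <hi (hi≤N a) , eq) (leg-off i t≤r)
        ... | inj₂ refl with f-injective (≤-trans <hi (hi≤N a)) (foot<N i) (trans eq (leg-end i))
        ...   | refl = ⊥-elim (foot-not-interior a i lo< <hi)
        on-arc (inj₂ b) t≤ eq (lo< , <hi) with arc-index b t≤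
        ... | w , lo≤ , ≤hi , eq-w , _ with m≤n⇒m<n∨m≡n (≤-trans ≤hi (hi≤N b))
        ...   | inj₂ refl with f-injective (≤-trans <hi (hi≤N a)) 0<N (trans eq (trans eq-w closed))
        ...     | refl = contradiction lo< λ ()
        on-arc (inj₂ b) t≤ eq (lo< , <hi) | w , lo≤ , ≤hi , eq-w , _ | inj₁ w<N
          with f-injective (≤-trans <hi (hi≤N a)) w<N (trans eq eq-w)
        ... | refl = cong inj₂ (arcs-apart a b lo< <hi lo≤ ≤hi)

      -- Among the positions from 0 to `N`, only 0 and `N` coincide, and every arc misses one of
      -- them: the first misses `N`, the others miss 0.
      window-injective : ∀ {s t} → s < t → t ≤ N → 0 < s ⊎ t < N → f s ≢ f t
      window-injective s<t t≤N side eq with m≤n⇒m<n∨m≡n t≤N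
      window-injective s<t t≤N side eq | inj₁ t<N = f-inj s<t t<N eq
      window-injective s<t t≤N (inj₂ t<N) eq | inj₂ refl = <-irrefl refl t<N
      window-injective s<t t≤N (inj₁ 0<s) eq | inj₂ refl = f-inj 0<s s<t (sym (trans eq closed))

      point-inj : ∀ x {s t} → s < t → t ≤ size x → point x s ≢ point x t
      point-inj (inj₁ i) {s} s<t t≤ eq with m≤n⇒m<n∨m≡n t≤
      ... | inj₁ (s≤s t≤r) = leg-inj i s<t t≤r eq
      ... | inj₂ refl = leg-off i (≤-pred s<t) (foot i , foot<N i , sym (trans eq (leg-end i)))
      point-inj (inj₂ 0F) s<t t≤ = window-injective s<t (≤-trans t≤ (<⇒≤ j<N)) (inj₂ (<-≤-trans (s≤s t≤) j<N))
      point-inj (inj₂ 1F) s<t t≤ = window-injective (+-monoʳ-< j s<t)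
        (≤-trans (+-monoʳ-≤ j t≤) (≤-trans (≤-reflexive (m+[n∸m]≡n (<⇒≤ j<k))) (<⇒≤ k<N)))
        (inj₁ (≤-trans 0<j (m≤m+n j _)))
      point-inj (inj₂ 2F) {s} {t} s<t t≤ eq =
        window-injective (∸-monoʳ-< s<t (≤-trans t≤ (m∸n≤m N k))) (m∸n≤m N s) (inj₁ 0<N∸t) (sym eq)
        where
        0<N∸t : 0 < N ∸ t
        0<N∸t = <-≤-trans (<-trans 0<j j<k) (≤-trans (≤-reflexive (sym (m∸[m∸n]≡n (<⇒≤ k<N)))) (∸-monoʳ-≤ N t≤))

      point-injective : ∀ x {s t} → s ≤ size x → t ≤ size x → point x s ≡ point x t → s ≡ t
      point-injective x {s} {t} s≤ t≤ eq with <-cmp s t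
      ... | tri< s<t _ _ = contradiction eq (point-inj x s<t t≤)
      ... | tri≈ _ s≡t _ = s≡t
      ... | tri> _ _ t<s = contradiction (sym eq) (point-inj x t<s s≤)

      point-~ : ∀ x {t} → t < size x → point x t ~ point x (suc t)
      point-~ (inj₁ i) t< = leg-~ i t<
      point-~ (inj₂ 0F) t< = f-~ (<-trans t< j<N)
      point-~ (inj₂ 1F) {t} t< = subst (λ u → f (j + t) ~ f u) (sym (+-suc j t))
        (f-~ (<-trans (<-≤-trans (+-monoʳ-< j t<) (≤-reflexive (m+[n∸m]≡n (<⇒≤ j<k)))) k<N))
      point-~ (inj₂ 2F) {t} t< = subst (λ u → f u ~ f (N ∸ suc t)) (sym (+-∸-assoc 1 t<N))
        (~-sym (f-~ (∸-monoʳ-< (s≤s z≤n) t<N)))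
        where
        t<N : t < N
        t<N = <-≤-trans t< (m∸n≤m N k)

      isk4 : ISK4 G
      isk4 = record
        { br = branch
        ; br-inj = branch-injective
        ; len = size ∘ kind
        ; len≥1 = size≥1 ∘ kind
        ; path = λ e t → point (kind e) (toℕ t)
        ; start = point-start
        ; end = λ e → trans (cong (point (kind e)) (Fin.toℕ-fromℕ _)) (point-end e)
        ; path-inj = λ e s t eq → Fin.toℕ-injective
            (point-injective (kind e) (Fin.toℕ≤pred[n] s) (Fin.toℕ≤pred[n] t) eq)
        ; path-adj = λ e t → subst (λ s → point (kind e) s ~ point (kind e) (suc (toℕ t)))
            (sym (Fin.toℕ-inject₁ t)) (point-~ (kind e) (Fin.toℕ<n t))
        ; internal-disjoint = λ e e′ s t 0<s s< eq → kind-injective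
            (disjoint (kind e) (kind e′) 0<s s< (Fin.toℕ≤pred[n] t) eq)
        ; induced = λ e e′ s t adj → fin-edge
            (edge (place (kind e) (Fin.toℕ≤pred[n] s)) (place (kind e′) (Fin.toℕ≤pred[n] t)) adj)
        }
        where
        path-at : (e : Fin 6) → Fin (suc (size (kind e))) → V
        path-at e t = point (kind e) (toℕ t)

        fin-edge : ∀ {u v} → Edge u v → ∃ λ e → Σ (Fin (size (kind e))) λ t →
          (u ≡ path-at e (inject₁ t) × v ≡ path-at e (suc t)) ⊎ (v ≡ path-at e (inject₁ t) × u ≡ path-at e (suc t))
        fin-edge {u} {v} (x , t , t< , eqs) = unkind x , reindex (kind (unkind x)) (kind-unkind x)
          where
          -- `kind (unkind x)` is `x` only propositionally, and `Fin (size z)` depends on it; hence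
          -- the generalisation before matching on `refl`.
          reindex : ∀ z → z ≡ x → Σ (Fin (size z)) λ t →
            (u ≡ point z (toℕ (inject₁ t)) × v ≡ point z (suc (toℕ t)))
            ⊎ (v ≡ point z (toℕ (inject₁ t)) × u ≡ point z (suc (toℕ t)))
          reindex z refl = fromℕ< t< , retarget eqs
            where
            back : toℕ (inject₁ (fromℕ< t<)) ≡ t
            back = trans (Fin.toℕ-inject₁ _) (Fin.toℕ-fromℕ< t<)
            here-eq : point x t ≡ point x (toℕ (inject₁ (fromℕ< t<)))
            here-eq = cong (point x) (sym back)
            next-eq : point x (suc t) ≡ point x (suc (toℕ (fromℕ< t<)))
            next-eq = cong (point x ∘ suc) (sym (Fin.toℕ-fromℕ< t<))
            retarget : _ → _
            retarget (inj₁ (p , q)) = inj₁ (trans p here-eq , trans q next-eq)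
            retarget (inj₂ (p , q)) = inj₂ (trans p here-eq , trans q next-eq)

  -- Shortest tripods.

  TriangleFree : Set
  TriangleFree = ∀ {u v w} → u ~ v → v ~ w → w ~ u → ⊥

  module Tripod (triangle-free : TriangleFree) (X : V → Set) where

    -- The bound is kept as a separate number so that the three ends can be permuted without
    -- changing it.
    Minimal : V → V → V → ℕ → Set
    Minimal α β γ m = ∀ {y a b c} → Walk X y α a → Walk X y β b → Walk X y γ c → m ≤ a + (b + c)

    swap₁₂ : ∀ {α β γ m} → Minimal α β γ m → Minimal β α γ m
    swap₁₂ min {a = a} {b} {c} p q w = ≤-trans (min q p w) (≤-reflexive (x+[y+z]≡y+[x+z] b a c))

    swap₂₃ : ∀ {α β γ m} → Minimal α β γ m → Minimal α γ β m
    swap₂₃ min {a = a} {b} {c} p q w = ≤-trans (min p w q) (≤-reflexive (cong (a +_) (+-comm c b)))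

    geodesic : ∀ {α β γ y a b c} → Minimal α β γ (a + (b + c)) →
      Walk X y β b → Walk X y γ c → Geodesic {X} y α a
    geodesic {a = a} {b} {c} min q w {m} p = +-cancelʳ-≤ (b + c) a m (min p q w)

    -- Moving the centre of the tripod to at p s changes its total length by -t, or
    -- by 1 - t if the legs are joined by an edge.
    module _ {α β γ y a b c} (p : Walk X y α a) (q : Walk X y β b) (w : Walk X y γ c) {m}
             (m≡ : m ≡ a + (b + c)) (min : Minimal α β γ m) {s t : ℕ} (s≤a : s ≤ a) (t≤b : t ≤ b) where

      private
        m≡′ : m ≡ t + ((a ∸ s) + ((b ∸ t) + (s + c)))
        m≡′ = trans (trans m≡ (cong₂ (λ x y → x + (y + c)) (sym (m+[n∸m]≡n s≤a)) (sym (m+[n∸m]≡n t≤b))))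
                (lemma s (a ∸ s) t (b ∸ t) c)
          where
          lemma : ∀ s a t b c → (s + a) + ((t + b) + c) ≡ t + (a + (b + (s + c)))
          lemma = solve-∀

      not-meeting : 0 < t → at p s ≢ at q t
      not-meeting 0<t eq = <⇒≱ (subst (_ <_) (sym m≡′) (m<n+m _ 0<t))
        (min (drop p s≤a) (subst (λ v → Walk X v β (b ∸ t)) (sym eq) (drop q t≤b)) (reverse (take p s≤a) ⊕ w))

      adjacent⇒≤1 : at p s ~ at q t → t ≤ 1
      adjacent⇒≤1 e = +-cancelʳ-≤ ((a ∸ s) + ((b ∸ t) + (s + c))) t 1 (≤-trans (≤-reflexive (sym m≡′))
        (≤-trans (min (drop p s≤a) (step (at-∈ p s) e (drop q t≤b)) (reverse (take p s≤a) ⊕ w))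
                 (≤-reflexive (+-suc (a ∸ s) _))))

    -- An edge between the legs forces `t ≤ 1` and, with the legs exchanged, `s ≤ 1`. Both are then
    -- 1, and the edge closes a triangle with the centre.
    apart : ∀ {α β γ y a b c} (p : Walk X y α a) (q : Walk X y β b) (w : Walk X y γ c) {m} →
      m ≡ a + (b + c) → Minimal α β γ m →
      ∀ {s t} → 0 < s → s ≤ a → 0 < t → t ≤ b → at p s ≢ at q t × ¬ at p s ~ at q t
    apart {a = a} {b} {c} p q w m≡ min {s} {t} 0<s s≤a 0<t t≤b =
      not-meeting p q w m≡ min s≤a t≤b 0<t , not-adjacent
      where
      not-adjacent : ¬ at p s ~ at q t
      not-adjacent e with ≤-antisym 0<t (adjacent⇒≤1 p q w m≡ min s≤a t≤b e)
                        | ≤-antisym 0<s (adjacent⇒≤1 q p w (trans m≡ (x+[y+z]≡y+[x+z] a b c)) (swap₁₂ min) t≤b s≤a (~-sym e))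
      ... | refl | refl = triangle-free (subst (_~ at p 1) (at-zero p) (at-~ p s≤a)) e
                            (~-sym (subst (_~ at q 1) (at-zero q) (at-~ q t≤b)))

    module _ (H : Hole) (X-off : ∀ {v} → X v → ¬ Hole.On H v)
      {j k : ℕ} (0<j : 0 < j) (j<k : j < k) (k<N : k < Hole.N H)
      {α β γ : V} (α~ : α ~ Hole.f H 0) (β~ : β ~ Hole.f H j) (γ~ : γ ~ Hole.f H k)
      (X-foot : ∀ {v u} → X v → Hole.On H u → v ~ u →
        (v ≡ α × u ≡ Hole.f H 0) ⊎ (v ≡ β × u ≡ Hole.f H j) ⊎ (v ≡ γ × u ≡ Hole.f H k))
      where

      open Hole H

      module _ {y a b c} (p : Walk X y α a) (q : Walk X y β b) (w : Walk X y γ c)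
               (min : Minimal α β γ (a + (b + c))) where

        private
          ends : Fin 3 → V
          ends 0F = α
          ends 1F = β
          ends 2F = γ

          r : Fin 3 → ℕ
          r 0F = a
          r 1F = b
          r 2F = c

          legs : ∀ i → Walk X y (ends i) (r i)
          legs 0F = p
          legs 1F = q
          legs 2F = w

          ends~ : ∀ i → ends i ~ f (feet j k i)
          ends~ 0F = α~
          ends~ 1F = β~
          ends~ 2F = γ~

          -- The last edge, into the hole, gives every leg positive length even if the centre is one
          -- of the ends. The foot lies outside `X`, hence the widening to all vertices.
          extended : ∀ i → Walk (λ _ → ⊤) y (f (feet j k i)) (suc (r i))
          extended i = snoc (widen (λ _ → tt) (legs i)) (ends~ i) tt

          leg : Fin 3 → ℕ → V
          leg i = at (extended i)

          leg≡ : ∀ i {t} → t ≤ r i → leg i t ≡ at (legs i) t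
          leg≡ i {t} t≤ = trans (at-snoc (widen (λ _ → tt) (legs i)) (ends~ i) tt t≤) (at-widen _ (legs i) t)

          legs-geodesic : ∀ i → Geodesic {X} y (ends i) (r i)
          legs-geodesic 0F = geodesic min q w
          legs-geodesic 1F = geodesic (subst (Minimal β α γ) (x+[y+z]≡y+[x+z] a b c) (swap₁₂ min)) p w
          legs-geodesic 2F = geodesic (subst (Minimal γ α β) (lemma a b c) (swap₁₂ (swap₂₃ min))) p q
            where
            lemma : ∀ x y z → x + (y + z) ≡ z + (x + y)
            lemma = solve-∀

          legs-apart : ∀ i i′ → i ≢ i′ → ∀ {s t} → 0 < s → s ≤ r i → 0 < t → t ≤ r i′ →
            at (legs i) s ≢ at (legs i′) t × ¬ at (legs i) s ~ at (legs i′) t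
          legs-apart 0F 0F i≢i′ = contradiction refl i≢i′
          legs-apart 1F 1F i≢i′ = contradiction refl i≢i′
          legs-apart 2F 2F i≢i′ = contradiction refl i≢i′
          legs-apart 0F 1F _ = apart p q w refl min
          legs-apart 0F 2F _ = apart p w q (cong (a +_) (+-comm b c)) (swap₂₃ min)
          legs-apart 1F 2F _ = apart q w p (lemma a b c) (swap₂₃ (swap₁₂ min))
            where
            lemma : ∀ x y z → x + (y + z) ≡ y + (z + x)
            lemma = solve-∀
          legs-apart 1F 0F _ 0<s s≤ 0<t t≤ with legs-apart 0F 1F (λ ()) 0<t t≤ 0<s s≤
          ... | ≢ , ≁ = ≢ ∘ sym , ≁ ∘ ~-sym
          legs-apart 2F 0F _ 0<s s≤ 0<t t≤ with legs-apart 0F 2F (λ ()) 0<t t≤ 0<s s≤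
          ... | ≢ , ≁ = ≢ ∘ sym , ≁ ∘ ~-sym
          legs-apart 2F 1F _ 0<s s≤ 0<t t≤ with legs-apart 1F 2F (λ ()) 0<t t≤ 0<s s≤
          ... | ≢ , ≁ = ≢ ∘ sym , ≁ ∘ ~-sym

          open Spider H j k 0<j j<k k<N y r leg

          at-end : ∀ i → leg i (r i) ≡ ends i
          at-end i = trans (leg≡ i ≤-refl) (at-last (legs i))

          induced : Induced
          induced = record
            { leg-start = λ i → at-zero (extended i)
            ; leg-end = λ i → at-last (extended i)
            ; leg-~ = λ i → at-~ (extended i)
            ; leg-off = λ i t≤ o → X-off (at-∈ (legs i) _) (subst On (leg≡ i t≤) o)
            ; leg-inj = λ i s<t t≤ eq → geodesic-injective (legs i) (legs-geodesic i) s<t t≤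
                (trans (sym (leg≡ i (≤-trans (<⇒≤ s<t) t≤))) (trans eq (leg≡ i t≤)))
            ; leg-ind = λ i s<t t≤ e → geodesic-induced (legs i) (legs-geodesic i) s<t t≤
                (subst₂ _~_ (leg≡ i (≤-trans (<⇒≤ s<t) t≤)) (leg≡ i t≤) e)
            ; leg-foot = leg-foot
            ; apart = λ i i′ i≢i′ 0<s s≤ 0<t t≤ → subst₂ (λ u v → u ≢ v × ¬ u ~ v)
                (sym (leg≡ i s≤)) (sym (leg≡ i′ t≤)) (legs-apart i i′ i≢i′ 0<s s≤ 0<t t≤)
            }
            where
            leg-foot : ∀ i {t v} → t ≤ r i → On v → leg i t ~ v → ∃ λ i′ → leg i t ≡ leg i′ (r i′) × v ≡ f (foot i′)
            leg-foot i t≤ o e with X-foot (at-∈ (legs i) _) o (subst (_~ _) (leg≡ i t≤) e)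
            ... | inj₁ (eq , eq′) = 0F , trans (leg≡ i t≤) (trans eq (sym (at-end 0F))) , eq′
            ... | inj₂ (inj₁ (eq , eq′)) = 1F , trans (leg≡ i t≤) (trans eq (sym (at-end 1F))) , eq′
            ... | inj₂ (inj₂ (eq , eq′)) = 2F , trans (leg≡ i t≤) (trans eq (sym (at-end 2F))) , eq′

        tripod-isk4 : ISK4 G
        tripod-isk4 = isk4 induced

      connected-isk4 : ∀ {l m} → Walk X α β l → Walk X β γ m → ¬ ¬ ISK4 G
      connected-isk4 p q noISK4 =
        least (λ m → ∃ λ y → ∃ λ a → ∃ λ b → ∃ λ c → Walk X y α a × Walk X y β b × Walk X y γ c × a + (b + c) ≡ m)
          -- The initial tripod has centre `β` and a leg of length 0 to `β` itself.
          _ (_ , _ , _ , _ , reverse p , stop (last p) , q , refl)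
          λ where
            _ (y , a , b , c , p , q , w , refl) min → noISK4 (tripod-isk4 p q w
              λ p′ q′ w′ → min _ (_ , _ , _ , _ , p′ , q′ , w′ , refl))

  -- Girth at least 5 excludes triangles and squares.

  SquareFree : Set
  SquareFree = ∀ {u v w x} → u ~ v → v ~ w → w ~ x → x ~ u → u ≢ w → v ≢ x → ⊥

  girth⇒triangle-free : GirthAtLeast G 5 → TriangleFree
  girth⇒triangle-free girth {u} {v} {w} uv vw wu = contradiction (girth cycle) λ { (s≤s (s≤s (s≤s ()))) }
    where
    c : Fin 3 → V
    c 0F = u
    c 1F = v
    c 2F = w
    c-inj : ∀ i j → c i ≡ c j → i ≡ j
    c-inj 0F 0F _ = refl
    c-inj 0F 1F eq = contradiction eq (~⇒≢ uv)
    c-inj 0F 2F eq = contradiction (sym eq) (~⇒≢ wu)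
    c-inj 1F 0F eq = contradiction (sym eq) (~⇒≢ uv)
    c-inj 1F 1F _ = refl
    c-inj 1F 2F eq = contradiction eq (~⇒≢ vw)
    c-inj 2F 0F eq = contradiction eq (~⇒≢ wu)
    c-inj 2F 1F eq = contradiction (sym eq) (~⇒≢ vw)
    c-inj 2F 2F _ = refl
    cycle : Cycle G
    cycle = record
      { m = 2 ; len≥3 = ≤-refl ; c = c ; c-inj = c-inj
      ; step = λ { 0F → uv ; 1F → vw } ; close = wu }

  girth⇒square-free : GirthAtLeast G 5 → SquareFree
  girth⇒square-free girth {u} {v} {w} {x} uv vw wx xu u≢w v≢x =
    contradiction (girth cycle) λ { (s≤s (s≤s (s≤s (s≤s ())))) }
    where
    c : Fin 4 → V
    c 0F = u
    c 1F = v
    c 2F = w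
    c 3F = x
    c-inj : ∀ i j → c i ≡ c j → i ≡ j
    c-inj 0F 0F _ = refl
    c-inj 0F 1F eq = contradiction eq (~⇒≢ uv)
    c-inj 0F 2F eq = contradiction eq u≢w
    c-inj 0F 3F eq = contradiction (sym eq) (~⇒≢ xu)
    c-inj 1F 0F eq = contradiction (sym eq) (~⇒≢ uv)
    c-inj 1F 1F _ = refl
    c-inj 1F 2F eq = contradiction eq (~⇒≢ vw)
    c-inj 1F 3F eq = contradiction eq v≢x
    c-inj 2F 0F eq = contradiction (sym eq) u≢w
    c-inj 2F 1F eq = contradiction (sym eq) (~⇒≢ vw)
    c-inj 2F 2F _ = refl
    c-inj 2F 3F eq = contradiction eq (~⇒≢ wx)
    c-inj 3F 0F eq = contradiction eq (~⇒≢ xu)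
    c-inj 3F 1F eq = contradiction (sym eq) v≢x
    c-inj 3F 2F eq = contradiction (sym eq) (~⇒≢ wx)
    c-inj 3F 3F _ = refl
    cycle : Cycle G
    cycle = record
      { m = 3 ; len≥3 = s≤s (s≤s (s≤s z≤n)) ; c = c ; c-inj = c-inj
      ; step = λ { 0F → uv ; 1F → vw ; 2F → wx } ; close = xu }

  -- Attached vertices with three distinct feet.

  module Attachments (triangle-free : TriangleFree) (free : ISK4-free G)
    (H : Hole) (R : V → Set) (R-off : ∀ {v} → R v → ¬ Hole.On H v)
    (foot-unique : ∀ {v a b} → R v → Hole.On H a → Hole.On H b → v ~ a → v ~ b → a ≡ b) where

    open Hole H

    Unattached : V → Set
    Unattached v = R v × (∀ {a} → On a → ¬ v ~ a)

    Attached : V → V → Set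
    Attached v a = R v × On a × v ~ a

    -- The vertices inside a link are unattached, so walking along it brings in no foot beyond those
    -- of its ends.
    Link : V → V → Set
    Link s s′ = s ~ s′ ⊎ ∃ λ u → ∃ λ u′ → ∃ λ l → s ~ u × Walk Unattached u u′ l × u′ ~ s′

    link-walk : ∀ {X s s′} → (∀ {v} → Unattached v → X v) → X s → X s′ → Link s s′ → ∃ (Walk X s s′)
    link-walk inc x x′ (inj₁ e) = _ , step x e (stop x′)
    link-walk inc x x′ (inj₂ (_ , _ , _ , e , p , e′)) = _ , step x e (snoc (widen inc p) e′ x′)

    module _ {α β γ a b c} (Aα : Attached α a) (Aβ : Attached β b) (Aγ : Attached γ c)
             (a≢b : a ≢ b) (a≢c : a ≢ c) (b≢c : b ≢ c) where

      private
        X : V → Set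
        X v = Unattached v ⊎ v ≡ α ⊎ v ≡ β ⊎ v ≡ γ

        X-R : ∀ {v} → X v → R v
        X-R (inj₁ (Rv , _)) = Rv
        X-R (inj₂ (inj₁ refl)) = proj₁ Aα
        X-R (inj₂ (inj₂ (inj₁ refl))) = proj₁ Aβ
        X-R (inj₂ (inj₂ (inj₂ refl))) = proj₁ Aγ

        X-foot : ∀ {v u} → X v → On u → v ~ u → (v ≡ α × u ≡ a) ⊎ (v ≡ β × u ≡ b) ⊎ (v ≡ γ × u ≡ c)
        X-foot (inj₁ (_ , un)) o e = contradiction e (un o)
        X-foot (inj₂ (inj₁ refl)) o e = let (Rα , o′ , e′) = Aα in inj₁ (refl , foot-unique Rα o o′ e e′)
        X-foot (inj₂ (inj₂ (inj₁ refl))) o e =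
          let (Rβ , o′ , e′) = Aβ in inj₂ (inj₁ (refl , foot-unique Rβ o o′ e e′))
        X-foot (inj₂ (inj₂ (inj₂ refl))) o e =
          let (Rγ , o′ , e′) = Aγ in inj₂ (inj₂ (refl , foot-unique Rγ o o′ e e′))

      -- The foot of `α` is rotated to position 0. The other two feet may follow in either order, so
      -- `β` and `γ` are exchanged if necessary, with walks rerouted through `β`.
      linked-isk4 : Link α β → Link β γ → ⊥
      linked-isk4 αβ βγ with proj₁ (proj₂ Aα)
      ... | i , i<N , refl with rotate i H i<N
      ...   | H′ , zero≡ , to , from with to (proj₁ (proj₂ Aβ)) | to (proj₁ (proj₂ Aγ))
      ...     | j , j<N , refl | k , k<N , refl = ordered (<-cmp j k)
        where
        open Hole H′ using () renaming (f to g; On to On′; N to N′)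
        open Tripod triangle-free X

        p = proj₂ (link-walk inj₁ (inj₂ (inj₁ refl)) (inj₂ (inj₂ (inj₁ refl))) αβ)
        q = proj₂ (link-walk inj₁ (inj₂ (inj₂ (inj₁ refl))) (inj₂ (inj₂ (inj₂ refl))) βγ)

        α~ : α ~ g 0
        α~ = subst (α ~_) (sym zero≡) (proj₂ (proj₂ Aα))

        off′ : ∀ {v} → X v → ¬ On′ v
        off′ x o = R-off (X-R x) (from o)

        nonzero : ∀ {t} → f i ≢ g t → 0 < t
        nonzero {zero} ≢ = contradiction (sym zero≡) ≢
        nonzero {suc _} _ = s≤s z≤n

        foot′ : ∀ {v u} → X v → On′ u → v ~ u → (v ≡ α × u ≡ g 0) ⊎ (v ≡ β × u ≡ g j) ⊎ (v ≡ γ × u ≡ g k)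
        foot′ x o e with X-foot x (from o) e
        ... | inj₁ (eq , eq′) = inj₁ (eq , trans eq′ (sym zero≡))
        ... | inj₂ eqs = inj₂ eqs

        foot″ : ∀ {v u} → X v → On′ u → v ~ u → (v ≡ α × u ≡ g 0) ⊎ (v ≡ γ × u ≡ g k) ⊎ (v ≡ β × u ≡ g j)
        foot″ x o e with foot′ x o e
        ... | inj₁ eqs = inj₁ eqs
        ... | inj₂ (inj₁ eqs) = inj₂ (inj₂ eqs)
        ... | inj₂ (inj₂ eqs) = inj₂ (inj₁ eqs)

        ordered : _ → ⊥
        ordered (tri< j<k _ _) = connected-isk4 H′ off′ (nonzero a≢b) j<k k<N
          α~ (proj₂ (proj₂ Aβ)) (proj₂ (proj₂ Aγ)) foot′ p q free
        ordered (tri≈ _ refl _) = b≢c refl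
        ordered (tri> _ _ k<j) = connected-isk4 H′ off′ (nonzero a≢c) k<j j<N
          α~ (proj₂ (proj₂ Aγ)) (proj₂ (proj₂ Aβ)) foot″ (p ⊕ q) (reverse q) free

    -- A walk in `R` with its unattached stretches contracted to links.
    data Chain : V → V → Set where
      []   : ∀ {s} → Chain s s
      link : ∀ {s s′ a v} → Link s s′ → Attached s′ a → Chain s′ v → Chain s v

    -- The walk is cut at its attached vertices. `chain-via` carries the current unattached stretch,
    -- which cannot last to the end because `v` is attached.
    chain-from : ∀ {s v c l} → Walk R s v l → Attached v c → (Chain s v → ⊥) → ⊥
    chain-via : ∀ {s u p v c l m} → s ~ u → Walk Unattached u p l → Walk R p v m → Attached v c →
      (Chain s v → ⊥) → ⊥

    chain-from (stop _) _ k = k []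
    chain-from (step _ e p) A k = em (∃ λ a → On a × _ ~ a) λ where
      (yes (a , o , e′)) → chain-from p A (k ∘ link (inj₁ e) (first p , o , e′))
      (no un) → chain-via e (stop (first p , λ o e′ → un (_ , o , e′))) p A k

    chain-via e w (stop _) (_ , o , e′) k = proj₂ (last w) o e′
    chain-via e w (step _ e″ p) A k = em (∃ λ a → On a × _ ~ a) λ where
      (yes (a , o , e′)) → chain-from p A (k ∘ link (inj₂ (_ , _ , _ , e , w , e″)) (first p , o , e′))
      (no un) → chain-via e (snoc w e″ (first p , λ o e′ → un (_ , o , e′))) p A k

    module _ (escape : ∀ {u b} → Unattached u → On b →
      ¬ ¬ (∃ λ z → ∃ λ w → ∃ λ d → ∃ λ l → Walk Unattached u z l × z ~ w × Attached w d × d ≢ b)) where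

      -- If two linked vertices s, s′ share the foot b, then escaping from the
      -- link yields a vertex linked to both whose foot is not b.
      third-foot : ∀ {α s v a b c} → Attached α a → Attached s b → a ≢ b → Link α s →
        Chain s v → Attached v c → c ≢ a → c ≢ b → ⊥
      third-foot Aα As a≢b αs [] Av c≢a c≢b =
        c≢b (foot-unique (proj₁ Av) (proj₁ (proj₂ Av)) (proj₁ (proj₂ As)) (proj₂ (proj₂ Av)) (proj₂ (proj₂ As)))
      third-foot {a = a} {b} Aα As a≢b αs (link {a = a′} ss′ As′ ch) Av c≢a c≢b with a′ Fin.≟ a | a′ Fin.≟ b
      -- The foot returns to `a`: the pair `s`, `s′` takes the place of `α`, `s`, with the two feet
      -- exchanged.
      ... | yes refl | _ = third-foot As As′ (a≢b ∘ sym) ss′ ch Av c≢b c≢a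
      ... | no a′≢a | no a′≢b = linked-isk4 Aα As As′ a≢b (a′≢a ∘ sym) (a′≢b ∘ sym) αs ss′
      -- Adjacent vertices with a common foot form a triangle with it.
      third-foot Aα As a≢b αs (link (inj₁ e) As′ ch) Av c≢a c≢b | no _ | yes refl =
        triangle-free e (proj₂ (proj₂ As′)) (~-sym (proj₂ (proj₂ As)))
      third-foot {a = a} Aα As a≢b αs (link (inj₂ (u , u′ , _ , e , p , e′)) As′ ch) Av c≢a c≢b | no _ | yes refl =
        escape (first p) (proj₁ (proj₂ As)) λ where
          (z , w , d , _ , q , zw , Aw , d≢b) → via z w d q zw Aw d≢b (d Fin.≟ a)
        where
        via : ∀ z w d {l} → Walk Unattached u z l → z ~ w → Attached w d → d ≢ _ → Dec (d ≡ a) → ⊥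
        via z w d q zw Aw d≢b (no d≢a) =
          linked-isk4 Aα As Aw a≢b (d≢a ∘ sym) (d≢b ∘ sym) αs (inj₂ (_ , _ , _ , e , q , zw))
        -- Now `w` has foot `a` and is linked to `s′`, which has foot `b`; these two replace `α` and
        -- `s`, and the chain is one link shorter.
        via z w d q zw Aw d≢b (yes refl) =
          third-foot Aw As′ a≢b (inj₂ (_ , _ , _ , ~-sym zw , reverse q ⊕ p , e′)) ch Av c≢a c≢b

      -- Follows the chain to the first change of foot. The walk from `y` is kept so that `s′` can
      -- be joined to whatever else is reached from `y`.
      second-foot : ∀ {y s v a c l} → Walk R y s l → Attached s a → Chain s v → Attached v c → c ≢ a →
        (∀ {s s′ b l} → Attached s a → Attached s′ b → a ≢ b → Link s s′ → Walk R y s′ l → ⊥) → ⊥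
      second-foot p As [] Av c≢a k =
        c≢a (foot-unique (proj₁ Av) (proj₁ (proj₂ Av)) (proj₁ (proj₂ As)) (proj₂ (proj₂ Av)) (proj₂ (proj₂ As)))
      second-foot {a = a} p As (link {a = b} ss′ As′ ch) Av c≢a k with a Fin.≟ b
      ... | no a≢b = k As As′ a≢b ss′ (p ⊕ proj₂ (link-walk proj₁ (proj₁ As) (proj₁ As′) ss′))
      ... | yes refl = second-foot (p ⊕ proj₂ (link-walk proj₁ (proj₁ As) (proj₁ As′) ss′)) As′ ch Av c≢a k

      -- `others` is used twice: for `a` it yields a second foot and thereby linked vertices with
      -- distinct feet `a` and `b`; for `b` it yields a foot different from both, at the end of a
      -- chain from `s′`.
      third-foot-impossible : ∀ {y a} → Attached y a →
        (∀ e → On e → ¬ ¬ (∃ λ v → ∃ λ c → ∃ λ l → Walk R y v l × Attached v c × c ≢ a × c ≢ e)) → ⊥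
      third-foot-impossible {y} {a} Ay others = others a (proj₁ (proj₂ Ay)) λ where
        (v , c , _ , p , Av , c≢a , _) → chain-from p Av λ ch →
          second-foot (stop (proj₁ Ay)) Ay ch Av c≢a λ {s} {s′} {b} As As′ a≢b ss′ q →
            others b (proj₁ (proj₂ As′)) λ where
              (v′ , c′ , _ , p′ , Av′ , c′≢a , c′≢b) → chain-from (reverse q ⊕ p′) Av′ λ ch′ →
                third-foot As As′ a≢b ss′ ch′ Av′ c′≢a c′≢b

  -- Connected sets, stars and fragments.

  Reach : (V → Set) → V → V → Set
  Reach X u v = ∃ (Walk X u v)

  Connected : (V → Set) → Set
  Connected D = ∀ {u v} → D u → D v → Reach D u v

  within-reach : ∀ {X u v w l} → Reach X u v → Walk X v w l → Walk (Reach X u) v w l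
  within-reach r (stop _) = stop r
  within-reach r@(_ , q) (step x e p) = step r e (within-reach (_ , snoc q e (first p)) p)

  reach-connected : ∀ {X u} → Connected (Reach X u)
  reach-connected (_ , p) (_ , q) =
    _ , reverse (within-reach (_ , stop (first p)) p) ⊕ within-reach (_ , stop (first p)) q

  -- Sets are bounded by covering lists because predicates on V are not assumed decidable.
  Cover : (V → Set) → ℕ → Set
  Cover D k = ∃ λ xs → length xs ≤ k × (∀ {v} → D v → v ∈ xs)

  cover-⊆ : ∀ {D Z k} → (∀ {v} → Z v → D v) → Cover D k → Cover Z k
  cover-⊆ Z⊆D (xs , len , cov) = xs , len , cov ∘ Z⊆D

  cover-⊂ : ∀ {D Z k d} → (∀ {v} → Z v → D v) → D d → ¬ Z d → Cover D (suc k) → Cover Z k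
  cover-⊂ {d = d} Z⊆D Dd ¬Zd (xs , len , cov) =
    filter ≢d? xs
    , ≤-pred (<-≤-trans (filter-notAll ≢d? xs (lose (cov Dd) λ d≢d → d≢d refl)) len)
    , λ Zv → ∈-filter⁺ ≢d? (cov (Z⊆D Zv)) λ { refl → ¬Zd Zv }
    where
    ≢d? : ∀ v → Dec (v ≢ d)
    ≢d? v = ¬? (v Fin.≟ d)

  record Star (k : ℕ) (D : V → Set) (b : V) : Set where
    field
      member    : V
      inhabited : D member
      connected : Connected D
      cover     : Cover D k
      boundary  : ∀ {d v} → D d → d ~ v → ¬ D v → v ~ b
      b∉D       : ¬ D b

  -- O supplies a path outside D from c back to q; together with a path through D
  -- from S to c it closes up to a cycle.
  record Fragment (k : ℕ) (D : V → Set) : Set₁ where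
    field
      O S       : V → Set
      q c s d   : V
      connected : Connected D
      cover     : Cover D k
      D∩O       : ∀ {v} → D v → ¬ O v
      S∩O       : ∀ {v} → S v → ¬ O v
      S∩D       : ∀ {v} → S v → ¬ D v
      Oq        : O q
      q≢c       : q ≢ c
      boundary  : ∀ {d v} → D d → d ~ v → ¬ D v → ¬ S v → v ≡ c
      S~q       : ∀ {v} → S v → v ~ q
      S-O       : ∀ {v o} → S v → O o → v ~ o → o ≡ q
      D-O       : ∀ {v o} → D v → O o → v ~ o → o ≡ c
      outside   : Reach O c q
      Ss        : S s
      s-nbr     : ∃ λ v → D v × s ~ v
      Dd        : D d
      d~c       : d ~ c

  -- Smaller stars by removing a closed neighbourhood.

  module Fragments (triangle-free : TriangleFree) (square-free : SquareFree) (free : ISK4-free G)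
    (degree≥3 : ∀ v h h′ → ∃ λ w → v ~ w × w ≢ h × w ≢ h′) where

    -- A second neighbour `v` of `d` is not adjacent to `h`, there being no triangles, and hence
    -- lies in `D`. Its component in `D` minus the closed neighbourhood of `h` is bounded by
    -- neighbours of `h`, and it has lost `d`.
    shrink : ∀ {D k h d} → Cover D (suc k) → D d → d ~ h →
      (∀ {z v} → D z → z ~ v → ¬ D v → v ≢ h → v ~ h) →
      (∀ Z → Star k Z h → ⊥) → ⊥
    shrink {D} {k} {h} {d} cov Dd d~h bd cont with degree≥3 d h h
    ... | v , d~v , v≢h , _ = em (D v) λ where
        (no ¬Dv) → ≁h (bd Dd d~v ¬Dv v≢h)
        (yes Dv) → cont Z record
          { member = v
          ; inhabited = _ , stop (Dv , v≢h , ≁h)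
          ; connected = reach-connected
          ; cover = cover-⊂ (proj₁ ∘ Z⊆X) Dd (λ Zd → proj₂ (proj₂ (Z⊆X Zd)) d~h) cov
          ; boundary = λ Zz z~w ¬Zw → ~-stable λ w≁h → em (D _) λ where
              (yes Dw) → ¬Zw (_ , snoc (proj₂ Zz) z~w (Dw , avoid Zz z~w , w≁h))
              (no ¬Dw) → w≁h (bd (proj₁ (Z⊆X Zz)) z~w ¬Dw (avoid Zz z~w))
          ; b∉D = λ Zh → proj₁ (proj₂ (Z⊆X Zh)) refl
          }
      where
      X Z : V → Set
      X w = D w × w ≢ h × ¬ w ~ h
      Z = Reach X v
      ≁h : ¬ v ~ h
      ≁h v~h = triangle-free d~v v~h (~-sym d~h)
      Z⊆X : ∀ {w} → Z w → X w
      Z⊆X (_ , p) = last p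
      avoid : ∀ {z w} → Z z → z ~ w → w ≢ h
      avoid Zz z~h refl = proj₂ (proj₂ (Z⊆X Zz)) z~h

    -- From stars to fragments.

    module _ {k D b} (star : Star (suc k) D b) (no-star : ∀ Z b → Star k Z b → ⊥)
             (no-fragment : Fragment (suc k) D → ⊥) where
      open Star star

      private
        Boundary : V → Set
        Boundary v = ¬ D v × ∃ λ d → D d × d ~ v

      -- `b` serves as `q`, and the outside path is the edge from `c` to `b`. Another boundary
      -- vertex adjacent to `c` would give a triangle with `b`; a neighbour of `b` in `D` would make
      -- `b` a boundary vertex and so adjacent to itself.
      star-fragment : ∀ {s c} → Boundary s → Boundary c → s ≢ c → Fragment (suc k) D
      star-fragment {s} {c} (¬Ds , v , Dv , v~s) (¬Dc , d , Dd , d~c) s≢c = record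
        { O = λ v → v ≡ b ⊎ v ≡ c
        ; S = λ v → Boundary v × v ≢ c
        ; q = b ; c = c ; s = s ; d = d
        ; connected = connected
        ; cover = cover
        ; D∩O = λ { Dv (inj₁ refl) → b∉D Dv ; Dv (inj₂ refl) → ¬Dc Dv }
        ; S∩O = λ { Sv (inj₁ refl) → ~-irrefl (to-b (proj₁ Sv)) ; Sv (inj₂ refl) → proj₂ Sv refl }
        ; S∩D = λ { ((¬Dv , _) , _) Dv → ¬Dv Dv }
        ; Oq = inj₁ refl
        ; q≢c = λ { refl → ~-irrefl (boundary Dd d~c ¬Dc) }
        ; boundary = λ Dd d~v ¬Dv ¬Sv → ≡-stable λ v≢c → ¬Sv ((¬Dv , _ , Dd , d~v) , v≢c)
        ; S~q = to-b ∘ proj₁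
        ; S-O = λ { Sv (inj₁ refl) _ → refl
                  ; Sv (inj₂ refl) v~c → ⊥-elim (triangle-free v~c c~b (~-sym (to-b (proj₁ Sv)))) }
        ; D-O = λ { Dv (inj₁ refl) v~b → ⊥-elim (~-irrefl (boundary Dv v~b b∉D)) ; Dv (inj₂ refl) _ → refl }
        ; outside = _ , step (inj₂ refl) c~b (stop (inj₁ refl))
        ; Ss = (¬Ds , v , Dv , v~s) , s≢c
        ; s-nbr = v , Dv , ~-sym v~s
        ; Dd = Dd
        ; d~c = d~c
        }
        where
        to-b : ∀ {v} → Boundary v → v ~ b
        to-b (¬Dv , _ , Dd , d~v) = boundary Dd d~v ¬Dv
        c~b : c ~ b
        c~b = boundary Dd d~c ¬Dc

      -- If there are no two boundary vertices, `shrink` applies around the only one, or around an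
      -- arbitrary neighbour of `member` if there is none.
      star-impossible : ⊥
      star-impossible = em (∃ Boundary) λ where
        (no none) →
          let (h , e , _) = degree≥3 member member member in
          shrink cover inhabited e (λ Dz z~v ¬Dv _ → ⊥-elim (none (_ , ¬Dv , _ , Dz , z~v))) λ Z → no-star Z h
        (yes (c , Bc@(_ , d , Dd , d~c))) → em (∃ λ s → Boundary s × s ≢ c) λ where
          (yes (s , Bs , s≢c)) → no-fragment (star-fragment Bs Bc s≢c)
          (no none) → shrink cover Dd d~c
            (λ Dz z~v ¬Dv v≢c → ⊥-elim (none (_ , (¬Dv , _ , Dz , z~v) , v≢c))) λ Z → no-star Z c

    -- The hole through a fragment.

    module _ {k D} (fragment : Fragment (suc k) D) (no-star : ∀ Z b → Star k Z b → ⊥)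
             (no-fragment : ∀ Z → Fragment k Z → ⊥) where
      open Fragment fragment

      private
        I : V → Set
        I v = S v ⊎ D v ⊎ v ≡ c

      module _ {w s₁} (Ss₁ : S s₁) (W : Walk I s₁ c w) (W-min : ∀ m → (∃ λ s → S s × Walk I s c m) → w ≤ m)
               {l} (Q : Walk O c q l) (Q-min : ∀ m → Walk O c q m → l ≤ m) where

        private
          Oc : O c
          Oc = first Q

          W-geo : Geodesic s₁ c w
          W-geo p = W-min _ (s₁ , Ss₁ , p)

          Q-geo : Geodesic c q l
          Q-geo = Q-min _

          -- `W` is shortest over all starts in `S`: a later vertex of `S` would be a better start,
          -- an earlier visit to `c` a better end.
          W-D : ∀ {i} → 0 < i → i < w → D (at W i)
          W-D {i} 0<i i<w with at-∈ W i
          ... | inj₁ Sv = contradiction (W-min _ (_ , Sv , drop W (<⇒≤ i<w))) (<⇒≱ (∸-monoʳ-< 0<i (<⇒≤ i<w)))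
          ... | inj₂ (inj₁ Dv) = Dv
          ... | inj₂ (inj₂ eq) =
            contradiction (W-geo (subst (λ v → Walk I s₁ v i) eq (take W (<⇒≤ i<w)))) (<⇒≱ i<w)

          2≤w : 2 ≤ w
          2≤w = long Ss₁ W
            where
            long : ∀ {s w} → S s → Walk I s c w → 2 ≤ w
            long Ss (stop _) = contradiction Oc (S∩O Ss)
            long Ss (step _ e (stop _)) = contradiction (sym (S-O Ss Oc e)) q≢c
            long Ss (step _ _ (step _ _ _)) = s≤s (s≤s z≤n)

          1≤w : 1 ≤ w
          1≤w = ≤-trans (s≤s z≤n) 2≤w

          Q≢c : ∀ {t} → 0 < t → t ≤ l → at Q t ≢ c
          Q≢c 0<t t≤l eq = geodesic-injective Q Q-geo 0<t t≤l (trans (at-zero Q) (sym eq))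

          Q≡q : ∀ {t} → t ≤ l → at Q t ≡ q → t ≡ l
          Q≡q t≤l eq with m≤n⇒m<n∨m≡n t≤l
          ... | inj₁ t<l = contradiction (trans eq (sym (at-last Q))) (geodesic-injective Q Q-geo t<l ≤-refl)
          ... | inj₂ t≡l = t≡l

          W⊕Q : Walk (λ _ → ⊤) s₁ q (w + l)
          W⊕Q = widen (λ _ → tt) W ⊕ widen (λ _ → tt) Q

          ring : Walk (λ _ → ⊤) s₁ s₁ (suc (w + l))
          ring = snoc W⊕Q (~-sym (S~q Ss₁)) tt

          f : ℕ → V
          f = at ring

          f-W : ∀ {t} → t ≤ w → f t ≡ at W t
          f-W {t} t≤w = trans (at-snoc W⊕Q _ tt (≤-trans t≤w (m≤m+n w l)))
            (trans (at-⊕ˡ (widen _ W) (widen _ Q) t≤w) (at-widen _ W t))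

          f-Q : ∀ {t} → t ≤ l → f (w + t) ≡ at Q t
          f-Q {t} t≤l = trans (at-snoc W⊕Q _ tt (+-monoʳ-≤ w t≤l))
            (trans (at-⊕ʳ (widen _ W) (widen _ Q) t) (at-widen _ Q t))

          -- The junction `c` counts as part of `W`, hence `0 < t` in `in-Q`.
          data Position : ℕ → Set where
            in-W : ∀ {t} → t ≤ w → Position t
            in-Q : ∀ {t} → 0 < t → t ≤ l → Position (w + t)

          position : ∀ {t} → t < suc (w + l) → Position t
          position {t} (s≤s t≤) with t ≤? w
          ... | yes t≤w = in-W t≤w
          ... | no t≰w = subst Position (m+[n∸m]≡n w≤t)
              (in-Q (m<n⇒0<n∸m w<t) (≤-trans (∸-monoˡ-≤ w t≤) (≤-reflexive (m+n∸m≡n w l))))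
            where
            w<t = ≰⇒> t≰w
            w≤t = <⇒≤ w<t

          I∩Q : ∀ {v} → I v → ∀ {t} → 0 < t → t ≤ l → v ≢ at Q t
          I∩Q (inj₁ Sv) _ _ refl = S∩O Sv (at-∈ Q _)
          I∩Q (inj₂ (inj₁ Dv)) _ _ refl = D∩O Dv (at-∈ Q _)
          I∩Q (inj₂ (inj₂ refl)) 0<t t≤l eq = Q≢c 0<t t≤l (sym eq)

          f-inj : ∀ {s t} → s < t → t < suc (w + l) → f s ≢ f t
          f-inj s<t t<N eq with position (<-trans s<t t<N) | position t<N
          ... | in-W s≤w | in-W t≤w =
            geodesic-injective W W-geo s<t t≤w (trans (sym (f-W s≤w)) (trans eq (f-W t≤w)))
          ... | in-W {s} s≤w | in-Q 0<t t≤l =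
            I∩Q (at-∈ W s) 0<t t≤l (trans (sym (f-W s≤w)) (trans eq (f-Q t≤l)))
          ... | in-Q {s} 0<s s≤l | in-W t≤w = <⇒≱ s<t (≤-trans t≤w (m≤m+n w s))
          ... | in-Q 0<s s≤l | in-Q 0<t t≤l =
            geodesic-injective Q Q-geo (+-cancelˡ-< w _ _ s<t) t≤l (trans (sym (f-Q s≤l)) (trans eq (f-Q t≤l)))

          f-ind : ∀ {s t} → s < t → t < suc (w + l) → f s ~ f t → t ≡ suc s ⊎ (s ≡ 0 × suc t ≡ suc (w + l))
          f-ind s<t t<N e with position (<-trans s<t t<N) | position t<N
          ... | in-W s≤w | in-W t≤w = inj₁ (geodesic-induced W W-geo s<t t≤w (subst₂ _~_ (f-W s≤w) (f-W t≤w) e))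
          ... | in-Q {s} 0<s s≤l | in-W t≤w = contradiction (≤-trans t≤w (m≤m+n w s)) (<⇒≱ s<t)
          ... | in-Q {s} 0<s s≤l | in-Q 0<t t≤l = inj₁ (trans
            (cong (w +_) (geodesic-induced Q Q-geo (+-cancelˡ-< w _ _ s<t) t≤l (subst₂ _~_ (f-Q s≤l) (f-Q t≤l) e)))
            (+-suc w s))
          f-ind s<t t<N e | in-W {s} s≤w | in-Q {t} 0<t t≤l = cross s s≤w (subst₂ _~_ (f-W s≤w) (f-Q t≤l) e)
            where
            -- From `s₁` only `q` can be reached, which is the closing edge. An inner vertex of `W`
            -- lies in `D` and could only see `c`, against `0 < t`. From `c`, the geodesic `Q`
            -- allows only its next vertex.
            cross : ∀ s → s ≤ w → at W s ~ at Q t → w + t ≡ suc s ⊎ (s ≡ 0 × suc (w + t) ≡ suc (w + l))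
            cross s s≤w e with m≤n⇒m<n∨m≡n s≤w
            cross zero s≤w e | _ = inj₂ (refl , cong (λ r → suc (w + r)) (Q≡q t≤l
              (S-O Ss₁ (at-∈ Q t) (subst (_~ at Q t) (at-zero W) e))))
            cross (suc s) s≤w e | inj₁ s<w =
              contradiction (D-O (W-D (s≤s z≤n) s<w) (at-∈ Q t) e) (Q≢c 0<t t≤l)
            cross (suc s) s≤w e | inj₂ refl = inj₁ (trans (cong (w +_) (geodesic-induced Q Q-geo 0<t t≤l
              (subst (_~ at Q t) (trans (at-last W) (sym (at-zero Q))) e))) (+-comm w 1))

        hole : Hole
        hole = record
          { N = suc (w + l)
          ; 2≤N = ≤-trans 2≤w (≤-trans (m≤m+n w l) (n≤1+n _))
          ; f = f
          ; closed = trans (at-last ring) (sym (at-zero ring))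
          ; f-~ = at-~ ring
          ; f-inj = f-inj
          ; f-ind = f-ind
          }

        open Hole hole using (N; On)

        private
          d₁ : V
          d₁ = at W 1

          Dd₁ : D d₁
          Dd₁ = W-D (s≤s z≤n) 2≤w

          s₁~d₁ : s₁ ~ d₁
          s₁~d₁ = subst (_~ d₁) (at-zero W) (at-~ W 1≤w)

          W-On : ∀ {t} → t ≤ w → On (at W t)
          W-On {t} t≤w = t , s≤s (≤-trans t≤w (m≤m+n w l)) , f-W t≤w

          On-s₁ : On s₁
          On-s₁ = subst On (at-zero W) (W-On z≤n)

          On-d₁ : On d₁
          On-d₁ = W-On 1≤w

          On-c : On c
          On-c = subst On (at-last W) (W-On ≤-refl)

          On-q : On q
          On-q = w + l , ≤-refl , trans (f-Q ≤-refl) (at-last Q)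

          On-view : ∀ {v} → On v → (∃ λ t → t ≤ w × at W t ≡ v) ⊎ (O v × v ≢ c)
          On-view (t , t<N , refl) with position t<N
          ... | in-W t≤w = inj₁ (_ , t≤w , sym (f-W t≤w))
          ... | in-Q 0<t t≤l = inj₂ (subst O (sym (f-Q t≤l)) (at-∈ Q _) , Q≢c 0<t t≤l ∘ trans (sym (f-Q t≤l)))

        -- Feet on the hole of a fragment.

        R : V → Set
        R v = (D v ⊎ S v) × ¬ On v

        D-foot : ∀ {v a} → D v → On a → v ~ a → ∃ λ t → t ≤ w × at W t ≡ a
        D-foot Dv o e with On-view o
        ... | inj₁ found = found
        ... | inj₂ (Oa , a≢c) = contradiction (D-O Dv Oa e) a≢c

        -- A neighbour on `W` at position 0 gives a triangle with `q`, at position 1 a square with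
        -- `s₁` and `q`, and further on a walk from `v` to `c` that is shorter than `W`.
        S-foot : ∀ {v a} → S v → ¬ On v → On a → v ~ a → a ≡ q
        S-foot {v} Sv off o e with On-view o
        ... | inj₂ (Oa , _) = S-O Sv Oa e
        ... | inj₁ (zero , _ , refl) =
          ⊥-elim (triangle-free (subst (v ~_) (at-zero W) e) (S~q Ss₁) (~-sym (S~q Sv)))
        ... | inj₁ (suc zero , _ , refl) = ⊥-elim (square-free e (~-sym s₁~d₁) (S~q Ss₁) (~-sym (S~q Sv))
            (λ { refl → off On-s₁ }) (λ d₁≡q → D∩O Dd₁ (subst O (sym d₁≡q) Oq)))
        ... | inj₁ (suc (suc t) , t≤w , refl) = contradiction
            (W-min _ (v , Sv , step (inj₁ Sv) e (drop W t≤w)))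
            (<⇒≱ (≤-trans (+-monoˡ-≤ (w ∸ suc (suc t)) (s≤s (s≤s z≤n))) (≤-reflexive (m+[n∸m]≡n t≤w))))

        -- Neighbours at distance 1 along `W` give a triangle, at distance 2 a square; beyond that,
        -- the two steps through `v` shorten `W`.
        D-foot-≤ : ∀ {v i j} → D v → ¬ On v → i < j → j ≤ w → v ~ at W i → ¬ v ~ at W j
        D-foot-≤ {v} {i} {j} Dv off i<j j≤w vi vj with m≤n⇒m<n∨m≡n i<j
        ... | inj₂ refl = triangle-free vi (at-~ W j≤w) (~-sym vj)
        ... | inj₁ si<j with m≤n⇒m<n∨m≡n si<j
        ...   | inj₂ refl = square-free (at-~ W (<-trans (n<1+n _) j≤w)) (at-~ W j≤w) (~-sym vj) vi
                  (geodesic-injective W W-geo i<j j≤w) (λ { refl → off (W-On (≤-trans (n≤1+n _) j≤w)) })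
        ...   | inj₁ ssi<j = contradiction
                  (W-geo (take W (≤-trans (<⇒≤ i<j) j≤w) ⊕ step (at-∈ W i) (~-sym vi) (step (inj₂ (inj₁ Dv)) vj (drop W j≤w))))
                  (<⇒≱ (subst (_< w) (shift i (w ∸ j)) (splice-< ssi<j j≤w)))
          where
          shift : ∀ i r → suc (suc i) + r ≡ i + suc (suc r)
          shift = solve-∀

        foot-unique : ∀ {v a b} → R v → On a → On b → v ~ a → v ~ b → a ≡ b
        foot-unique (inj₂ Sv , off) oa ob va vb = trans (S-foot Sv off oa va) (sym (S-foot Sv off ob vb))
        foot-unique (inj₁ Dv , off) oa ob va vb with D-foot Dv oa va | D-foot Dv ob vb
        ... | i , i≤w , refl | j , j≤w , refl with <-cmp i j
        ...   | tri< i<j _ _ = contradiction vb (D-foot-≤ Dv off i<j j≤w va)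
        ...   | tri≈ _ refl _ = refl
        ...   | tri> _ _ j<i = contradiction va (D-foot-≤ Dv off j<i i≤w vb)

        open Attachments triangle-free free hole R proj₂ foot-unique

        unattached⇒D : ∀ {v} → Unattached v → D v
        unattached⇒D ((inj₁ Dv , _) , _) = Dv
        unattached⇒D ((inj₂ Sv , _) , un) = ⊥-elim (un On-q (S~q Sv))

        escape : ∀ {u b} → Unattached u → On b →
          ¬ ¬ (∃ λ z → ∃ λ w → ∃ λ d → ∃ λ l → Walk Unattached u z l × z ~ w × Attached w d × d ≢ b)
        -- Otherwise the unattached vertices reachable from u form a smaller star fragment.
        escape {u} {b} Uu ob none = no-star Z b record
          { member = u
          ; inhabited = _ , stop Uu
          ; connected = reach-connected
          ; cover = cover-⊂ (unattached⇒D ∘ Z⊆U) Dd₁ (λ Zd → off Zd On-d₁) cover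
          ; boundary = λ Zz z~v ¬Zv → ~-stable λ v≁b → em (On _) λ where
              (yes ov) → proj₂ (Z⊆U Zz) ov z~v
              (no off-v) → em (∃ λ d → On d × _ ~ d) λ where
                (no un) → in-R Zz z~v off-v λ Rv →
                  ¬Zv (_ , snoc (proj₂ Zz) z~v (Rv , λ o e → un (_ , o , e)))
                (yes (d , od , v~d)) → in-R Zz z~v off-v λ Rv →
                  none (_ , _ , d , _ , proj₂ Zz , z~v , (Rv , od , v~d) , λ { refl → v≁b v~d })
          ; b∉D = λ Zb → off Zb ob
          }
          where
          Z : V → Set
          Z = Reach Unattached u
          Z⊆U : ∀ {v} → Z v → Unattached v
          Z⊆U (_ , p) = last p
          off : ∀ {v} → Z v → ¬ On v
          off Zv = proj₂ (proj₁ (Z⊆U Zv))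
          in-R : ∀ {z v} → Z z → z ~ v → ¬ On v → (R v → ⊥) → ⊥
          in-R Zz z~v off-v cont = em (D _) λ where
            (yes Dv) → cont (inj₁ Dv , off-v)
            (no ¬Dv) → em (S _) λ where
              (yes Sv) → cont (inj₂ Sv , off-v)
              (no ¬Sv) → off-v (subst On (sym (boundary (unattached⇒D (Z⊆U Zz)) z~v ¬Dv ¬Sv)) On-c)

        -- Components whose feet are confined to two vertices.

        module _ {y} (Dy : D y) (off-y : ¬ On y) (y~d₁ : y ~ d₁) (e : V) (On-e : On e)
          (none : ¬ ∃ λ v → ∃ λ c → ∃ λ l → Walk R y v l × Attached v c × c ≢ d₁ × c ≢ e) where

          private
            Z : V → Set
            Z = Reach (λ v → D v × ¬ On v) y

            Zy : Z y
            Zy = _ , stop (Dy , off-y)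

            Z⊆D : ∀ {v} → Z v → D v
            Z⊆D (_ , p) = proj₁ (last p)

            Z-off : ∀ {v} → Z v → ¬ On v
            Z-off (_ , p) = proj₂ (last p)

            Z-walk : ∀ {v} → Z v → Reach R y v
            Z-walk (_ , p) = _ , widen (λ { (Dv , off) → inj₁ Dv , off }) p

            cover-Z : Cover Z k
            cover-Z = cover-⊂ Z⊆D Dd₁ (λ Zd → Z-off Zd On-d₁) cover

            reached-foot : ∀ {v a} → Reach R y v → On a → v ~ a → a ≡ d₁ ⊎ a ≡ e
            reached-foot {a = a} (_ , p) o va with a Fin.≟ d₁ | a Fin.≟ e
            ... | yes eq | _ = inj₁ eq
            ... | no _ | yes eq = inj₂ eq
            ... | no ≢d₁ | no ≢e = ⊥-elim (none (_ , _ , _ , p , (last p , o , va) , ≢d₁ , ≢e))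

            Z-foot : ∀ {z a} → Z z → On a → z ~ a → a ≡ d₁ ⊎ a ≡ e
            Z-foot = reached-foot ∘ Z-walk

            Z-boundary : ∀ {z v} → Z z → z ~ v → ¬ Z v → ¬ On v → ¬ S v → ⊥
            Z-boundary Zz z~v ¬Zv off-v ¬Sv = em (D _) λ where
              (yes Dv) → ¬Zv (_ , snoc (proj₂ Zz) z~v (Dv , off-v))
              (no ¬Dv) → off-v (subst On (sym (boundary (Z⊆D Zz) z~v ¬Dv ¬Sv)) On-c)

          -- The foot of a vertex of `S` is `q`, so `e` is `q`, which has no neighbour in `D`. Thus
          -- `d₁` is the only possible foot of `Z`, and the path `d₁`, `s₁`, `q` lies outside a
          -- smaller fragment.
          through-S : ∀ {z v} → Z z → z ~ v → S v → ¬ On v → ⊥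
          through-S {z} {s} Zz z~s Ss off-s
            with reached-foot (_ , snoc (proj₂ (Z-walk Zz)) z~s (inj₂ Ss , off-s)) On-q (S~q Ss)
          ... | inj₁ q≡d₁ = D∩O Dd₁ (subst O q≡d₁ Oq)
          ... | inj₂ refl = no-fragment Z record
            { O = λ v → v ≡ q ⊎ v ≡ s₁ ⊎ v ≡ d₁
            ; S = λ v → S v × ¬ On v
            ; q = q ; c = d₁ ; s = s ; d = y
            ; connected = reach-connected
            ; cover = cover-Z
            ; D∩O = λ Zv Ov → Z-off Zv (O-On Ov)
            ; S∩O = λ Sv Ov → proj₂ Sv (O-On Ov)
            ; S∩D = λ Sv Zv → S∩D (proj₁ Sv) (Z⊆D Zv)
            ; Oq = inj₁ refl
            ; q≢c = λ q≡d₁ → D∩O Dd₁ (subst O q≡d₁ Oq)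
            ; boundary = λ Zz z~v ¬Zv ¬Sv → ≡-stable λ v≢d₁ → em (On _) λ where
                (yes o) → v≢d₁ (Z-foot≡d₁ Zz o z~v)
                (no off) → Z-boundary Zz z~v ¬Zv off λ Sv → ¬Sv (Sv , off)
            ; S~q = S~q ∘ proj₁
            ; S-O = λ { (Sv , off) Oo v~o → S-foot Sv off (O-On Oo) v~o }
            ; D-O = λ Zz Oo z~o → Z-foot≡d₁ Zz (O-On Oo) z~o
            ; outside = _ , step (inj₂ (inj₂ refl)) (~-sym s₁~d₁)
                (step (inj₂ (inj₁ refl)) (S~q Ss₁) (stop (inj₁ refl)))
            ; Ss = Ss , off-s
            ; s-nbr = z , Zz , ~-sym z~s
            ; Dd = Zy
            ; d~c = y~d₁
            }
            where
            O-On : ∀ {v} → v ≡ q ⊎ v ≡ s₁ ⊎ v ≡ d₁ → On v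
            O-On (inj₁ refl) = On-q
            O-On (inj₂ (inj₁ refl)) = On-s₁
            O-On (inj₂ (inj₂ refl)) = On-d₁
            Z-foot≡d₁ : ∀ {z a} → Z z → On a → z ~ a → a ≡ d₁
            Z-foot≡d₁ Zz o z~a with Z-foot Zz o z~a
            ... | inj₁ eq = eq
            ... | inj₂ refl = contradiction (D-O (Z⊆D Zz) Oq z~a) q≢c

          module _ (no-S : ∀ {z v} → Z z → z ~ v → S v → ¬ On v → ⊥) where

            private
              Z-boundary-foot : ∀ {z v} → Z z → z ~ v → ¬ Z v → ¬ ¬ (v ≡ d₁ ⊎ v ≡ e)
              Z-boundary-foot Zz z~v ¬Zv cont = em (On _) λ where
                (yes o) → cont (Z-foot Zz o z~v)
                (no off) → Z-boundary Zz z~v ¬Zv off λ Sv → no-S Zz z~v Sv off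

            -- The hypothesis places the whole boundary of `Z` in the closed neighbourhood of `d₁`.
            through-d₁ : (∀ {z} → Z z → z ~ e → e ≢ d₁ → ¬ ¬ e ~ d₁) → ⊥
            through-d₁ near = shrink (cover-⊆ Z⊆D cover) Zy y~d₁
              (λ Zz z~v ¬Zv v≢d₁ → ~-stable λ v≁d₁ → Z-boundary-foot Zz z~v ¬Zv λ where
                (inj₁ eq) → v≢d₁ eq
                (inj₂ refl) → near Zz z~v v≢d₁ v≁d₁)
              λ Z → no-star Z d₁

            -- `e` alone forms the new `S`, its predecessor on the hole is the new `q`, and the arc
            -- from `d₁` to that predecessor is the outside path. Positions 0, 1 and 2 hold `d₁` and
            -- its hole neighbours, so the predecessor differs from `d₁`.
            through-arc : ∀ {z} t → t < N → f t ≡ e → Z z → z ~ e → e ≢ d₁ → ¬ e ~ d₁ → ⊥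
            through-arc zero _ eq _ _ _ e≁d₁ = e≁d₁ (subst (_~ d₁) (trans (sym (at-zero ring)) eq) s₁~d₁)
            through-arc (suc zero) _ eq _ _ e≢d₁ _ = e≢d₁ (trans (sym eq) (f-W 1≤w))
            through-arc (suc (suc zero)) _ eq _ _ _ e≁d₁ =
              e≁d₁ (subst (_~ d₁) (trans (sym (f-W 2≤w)) eq) (~-sym (at-~ W 2≤w)))
            through-arc {z} (suc t@(suc (suc t-2))) st<N eq Zz z~e e≢d₁ e≁d₁ = no-fragment Z record
              { O = Arc
              ; S = _≡ e
              ; q = f t ; c = d₁ ; s = e ; d = y
              ; connected = reach-connected
              ; cover = cover-Z
              ; D∩O = λ Zv Av → Z-off Zv (Arc-On Av)
              ; S∩O = λ v≡e Av → Arc-≢ Av v≡e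
              ; S∩D = λ v≡e Zv → Z-off Zv (subst On (sym v≡e) On-e)
              ; Oq = t , s≤s z≤n , ≤-refl , refl
              ; q≢c = λ f≡d₁ → f-inj (s≤s (s≤s z≤n)) t<N (trans (f-W 1≤w) (sym f≡d₁))
              ; boundary = λ Zz z~v ¬Zv v≢e → ≡-stable λ v≢d₁ → Z-boundary-foot Zz z~v ¬Zv λ where
                  (inj₁ v≡d₁) → v≢d₁ v≡d₁
                  (inj₂ v≡e) → v≢e v≡e
              ; S~q = λ v≡e → ~-sym (subst (f t ~_) (trans eq (sym v≡e)) (at-~ ring t<N))
              ; S-O = λ v≡e Ao v~o → S-Arc Ao (subst (_~ _) (trans v≡e (sym eq)) v~o)
              ; D-O = Z-Arc
              ; outside = _ , subst (λ v → Walk Arc v (f t) (suc t-2)) (f-W 1≤w) (along (suc t-2) ≤-refl)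
              ; Ss = refl
              ; s-nbr = z , Zz , ~-sym z~e
              ; Dd = Zy
              ; d~c = y~d₁
              }
              where
              Arc : V → Set
              Arc v = ∃ λ i → 0 < i × i ≤ t × f i ≡ v
              t<N : t < N
              t<N = <-trans (n<1+n t) st<N
              Arc-On : ∀ {v} → Arc v → On v
              Arc-On (i , _ , i≤t , f≡v) = i , ≤-trans (s≤s i≤t) t<N , f≡v
              Arc-≢ : ∀ {v} → Arc v → v ≢ e
              Arc-≢ (i , _ , i≤t , f≡v) v≡e = f-inj (s≤s i≤t) st<N (trans f≡v (trans v≡e (sym eq)))
              S-Arc : ∀ {o} → Arc o → f (suc t) ~ o → o ≡ f t
              S-Arc (i , 0<i , i≤t , refl) adj with f-ind (s≤s i≤t) st<N (~-sym adj)
              ... | inj₁ refl = refl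
              ... | inj₂ (refl , _) = contradiction 0<i λ ()
              Z-Arc : ∀ {v o} → Z v → Arc o → v ~ o → o ≡ d₁
              Z-Arc Zv Ao v~o with Z-foot Zv (Arc-On Ao) v~o
              ... | inj₁ o≡d₁ = o≡d₁
              ... | inj₂ o≡e = contradiction o≡e (Arc-≢ Ao)
              along : ∀ m → suc m ≤ t → Walk Arc (f 1) (f (suc m)) m
              along zero m≤ = stop (1 , s≤s z≤n , m≤ , refl)
              along (suc m) m≤ = snoc (along m (≤-trans (n≤1+n _) m≤)) (at-~ ring (≤-trans m≤ (<⇒≤ t<N)))
                (suc (suc m) , s≤s z≤n , m≤ , refl)

          third-foot-exists : ⊥
          third-foot-exists = em (∃ λ z → ∃ λ v → Z z × z ~ v × S v × ¬ On v) λ where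
            (yes (z , v , Zz , z~v , Sv , off)) → through-S Zz z~v Sv off
            (no no-S) →
              let no-S′ = λ {z} {v} Zz z~v Sv off → no-S (z , v , Zz , z~v , Sv , off)
              in em (∃ λ z → Z z × z ~ e × e ≢ d₁ × ¬ e ~ d₁) λ where
                (yes (z , Zz , z~e , e≢d₁ , e≁d₁)) → through-arc no-S′ (proj₁ On-e) (proj₁ (proj₂ On-e)) (proj₂ (proj₂ On-e)) Zz z~e e≢d₁ e≁d₁
                (no no-arc) → through-d₁ no-S′ λ Zz z~e e≢d₁ e≁d₁ → no-arc (_ , Zz , z~e , e≢d₁ , e≁d₁)

        -- By its degree, `d₁` has a neighbour `y` besides its two hole neighbours, and `y` is off
        -- the hole because the hole is induced. In `S` it would complete a square with `d₁`, `s₁`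
        -- and `q`; hence it lies in `D` and starts the search for feet.
        ring-impossible : ⊥
        ring-impossible with degree≥3 d₁ s₁ (at W 2)
        ... | y , d₁~y , y≢s₁ , y≢d₂ = em (D y) λ where
            (yes Dy) → third-foot-impossible escape ((inj₁ Dy , off) , On-d₁ , ~-sym d₁~y)
              λ e On-e none → third-foot-exists Dy off (~-sym d₁~y) e On-e none
            (no ¬Dy) → em (S y) λ where
              (yes Sy) → square-free (~-sym d₁~y) (~-sym s₁~d₁) (S~q Ss₁) (~-sym (S~q Sy))
                y≢s₁ (λ d₁≡q → D∩O Dd₁ (subst O (sym d₁≡q) Oq))
              (no ¬Sy) → off (subst On (sym (boundary Dd₁ d₁~y ¬Dy ¬Sy)) On-c)
          where
          off : ¬ On y
          off (zero , _ , eq) = y≢s₁ (trans (sym eq) (at-zero ring))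
          off (suc zero , _ , eq) = ~⇒≢ d₁~y (trans (sym (f-W 1≤w)) eq)
          off (suc (suc t) , t<N , refl) with f-ind (s≤s (s≤s z≤n)) t<N (subst (_~ y) (sym (f-W 1≤w)) d₁~y)
          ... | inj₁ refl = y≢d₂ (f-W 2≤w)

      fragment-impossible : ⊥
      fragment-impossible =
        let (v , Dv , s~v) = s-nbr
            (_ , p) = connected Dv Dd
            start = step (inj₁ Ss) s~v (snoc (widen (inj₂ ∘ inj₁) p) d~c (inj₂ (inj₂ refl)))
        in least (λ m → ∃ λ s → S s × Walk I s c m) _ (_ , Ss , start) λ where
          w (s₁ , Ss₁ , W) W-min → least (Walk O c q) _ (proj₂ outside) λ l Q Q-min →
            ring-impossible Ss₁ W W-min Q Q-min

    impossible : ∀ k → (∀ D b → Star k D b → ⊥) × (∀ D → Fragment k D → ⊥)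
    impossible zero = (λ D b st → empty (Star.cover st) (Star.inhabited st))
                    , (λ D fr → empty (Fragment.cover fr) (Fragment.Dd fr))
      where
      empty : ∀ {D v} → Cover D 0 → ¬ D v
      empty ([] , _ , cov) Dv with cov Dv
      ... | ()
    impossible (suc k) = let (no-star , no-fragment) = impossible k
                             no-fragment′ = λ D fr → fragment-impossible fr no-star no-fragment
                         in (λ D b st → star-impossible st no-star (no-fragment′ D)) , no-fragment′

    minimum-degree-3-impossible : V → ⊥
    minimum-degree-3-impossible v =
      let (h , v~h , _) = degree≥3 v v v
      -- The set of all vertices has empty boundary; `n≤1+n` puts its cover into the successor form
      -- that `shrink` expects.
      in shrink {D = λ _ → ⊤} (allFin n , n≤1+n _ , λ _ → ∈-allFin _) tt v~h
           (λ _ _ ¬D _ → contradiction tt ¬D) λ Z → proj₁ (impossible _) Z h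

-- Low degree and free colours.

module _ {n : ℕ} (G : Graph n) where
  open Walks G
  open Graph G using (E)

  private
    neighbours : V → List V
    neighbours v = filter (λ w → T? (E v w)) (allFin n)

    T⇒~ : ∀ {u v} → T (E u v) → u ~ v
    T⇒~ {u} {v} t with E u v
    ... | true = refl

    ~⇒T : ∀ {u v} → u ~ v → T (E u v)
    ~⇒T e = subst T (sym e) tt

    ∈-neighbours : ∀ {v w} → v ~ w → w ∈ neighbours v
    ∈-neighbours {v} e = ∈-filter⁺ (λ w → T? (E v w)) (∈-allFin _) (~⇒T e)

    unique-pair : ∀ {h h′ : V} xs → Unique xs → (∀ {w} → w ∈ xs → w ≡ h ⊎ w ≡ h′) → length xs ≤ 2
    unique-pair [] _ _ = z≤n
    unique-pair (_ ∷ []) _ _ = s≤s z≤n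
    unique-pair (_ ∷ _ ∷ []) _ _ = ≤-refl
    unique-pair (x ∷ y ∷ z ∷ _) ((x≢y ∷ x≢z ∷ _) ∷ (y≢z ∷ _) ∷ _) pair
      with pair (here refl) | pair (there (here refl)) | pair (there (there (here refl)))
    ... | inj₁ p | inj₁ q | _ = contradiction (trans p (sym q)) x≢y
    ... | inj₁ p | inj₂ _ | inj₁ r = contradiction (trans p (sym r)) x≢z
    ... | inj₁ _ | inj₂ q | inj₂ r = contradiction (trans q (sym r)) y≢z
    ... | inj₂ _ | inj₁ q | inj₁ r = contradiction (trans q (sym r)) y≢z
    ... | inj₂ p | inj₁ _ | inj₂ r = contradiction (trans p (sym r)) x≢z
    ... | inj₂ p | inj₂ q | _ = contradiction (trans p (sym q)) x≢y

  third-neighbour : ∀ v → ¬ degree G v ≤ 2 → ∀ h h′ → ∃ λ w → v ~ w × w ≢ h × w ≢ h′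
  third-neighbour v big h h′
    with Fin.any? (λ w → (v ~? w) ×-dec ¬? (w Fin.≟ h) ×-dec ¬? (w Fin.≟ h′))
  ... | yes found = found
  ... | no none = contradiction
      (unique-pair (neighbours v) (filter⁺ (λ w → T? (E v w)) (allFin⁺ n)) pair) big
    where
    pair : ∀ {w} → w ∈ neighbours v → w ≡ h ⊎ w ≡ h′
    pair {w} w∈ with w Fin.≟ h | w Fin.≟ h′
    ... | yes eq | _ = inj₁ eq
    ... | no _ | yes eq = inj₂ eq
    ... | no ≢h | no ≢h′ =
      contradiction (w , T⇒~ (proj₂ (∈-filter⁻ (λ w → T? (E v w)) {xs = allFin n} w∈)) , ≢h , ≢h′) none

  -- Existence is decided by a finite search, so refuting the negative answer yields an actual
  -- vertex, although the refutation is classical.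
  low-degree : ISK4-free G → GirthAtLeast G 5 → V → ∃ λ v → degree G v ≤ 2
  low-degree free girth v₀ with Fin.any? (λ v → degree G v ≤? 2)
  ... | yes found = found
  ... | no none = ⊥-elim (minimum-degree-3-impossible v₀)
    where
    open Fragments (girth⇒triangle-free girth) (girth⇒square-free girth) free
      (λ v → third-neighbour v λ small → none (v , small))

  private
    third-colour : (x y : Fin 3) → ∃ λ z → z ≢ x × z ≢ y
    third-colour 0F 0F = 1F , (λ ()) , λ ()
    third-colour 0F 1F = 2F , (λ ()) , λ ()
    third-colour 0F 2F = 1F , (λ ()) , λ ()
    third-colour 1F 0F = 2F , (λ ()) , λ ()
    third-colour 1F 1F = 0F , (λ ()) , λ ()
    third-colour 1F 2F = 0F , (λ ()) , λ ()
    third-colour 2F 0F = 1F , (λ ()) , λ ()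
    third-colour 2F 1F = 0F , (λ ()) , λ ()
    third-colour 2F 2F = 0F , (λ ()) , λ ()

    avoiding : (g : V → Fin 3) → ∀ xs → length xs ≤ 2 → ∃ λ z → ∀ {w} → w ∈ xs → z ≢ g w
    avoiding g [] _ = 0F , λ ()
    avoiding g (x ∷ []) _ = let (z , ≢x , _) = third-colour (g x) (g x) in z , λ { (here refl) → ≢x }
    avoiding g (x ∷ y ∷ []) _ = let (z , ≢x , ≢y) = third-colour (g x) (g y) in
      z , λ { (here refl) → ≢x ; (there (here refl)) → ≢y }
    avoiding g (_ ∷ _ ∷ _ ∷ _) (s≤s (s≤s ()))

  free-colour : ∀ v → degree G v ≤ 2 → (g : V → Fin 3) → ∃ λ z → ∀ {w} → v ~ w → z ≢ g w
  free-colour v small g = let (z , avoids) = avoiding g (neighbours v) small in z , avoids ∘ ∈-neighbours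

-- Deleting a vertex and extending a colouring.

_-_ : ∀ {n} → Graph (suc n) → Fin (suc n) → Graph n
G - v = record
  { E = λ x y → Graph.E G (punchIn v x) (punchIn v y)
  ; sym = λ x y → Graph.sym G (punchIn v x) (punchIn v y)
  ; irref = λ x → Graph.irref G (punchIn v x)
  }

module _ {n : ℕ} (G : Graph (suc n)) (v : Fin (suc n)) where

  deletion-cycle : Cycle (G - v) → Cycle G
  deletion-cycle C = record
    { m = m ; len≥3 = len≥3 ; c = punchIn v ∘ c
    ; c-inj = λ i j eq → c-inj i j (Fin.punchIn-injective v _ _ eq)
    ; step = step ; close = close }
    where open Cycle C

  -- Adjacency in `G - v` is by computation that of `G`, so only equations between vertices have to
  -- be transported.
  deletion-isk4 : ISK4 (G - v) → ISK4 G
  deletion-isk4 K = record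
    { br = punchIn v ∘ br
    ; br-inj = λ i j eq → br-inj i j (cancel eq)
    ; len = len ; len≥1 = len≥1
    ; path = λ e → punchIn v ∘ path e
    ; start = λ e → cong (punchIn v) (start e)
    ; end = λ e → cong (punchIn v) (end e)
    ; path-inj = λ e k l eq → path-inj e k l (cancel eq)
    ; path-adj = path-adj
    ; internal-disjoint = λ e f k l 0<k k< eq → internal-disjoint e f k l 0<k k< (cancel eq)
    ; induced = λ e f k l adj → lift (induced e f k l adj)
    }
    where
    open ISK4 K
    cancel : ∀ {x y} → punchIn v x ≡ punchIn v y → x ≡ y
    cancel = Fin.punchIn-injective v _ _
    lift : ∀ {x y} →
      (∃ λ g → Σ (Fin (len g)) λ j → (x ≡ path g (inject₁ j) × y ≡ path g (suc j)) ⊎ (y ≡ path g (inject₁ j) × x ≡ path g (suc j))) →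
      ∃ λ g → Σ (Fin (len g)) λ j →
        (punchIn v x ≡ punchIn v (path g (inject₁ j)) × punchIn v y ≡ punchIn v (path g (suc j)))
        ⊎ (punchIn v y ≡ punchIn v (path g (inject₁ j)) × punchIn v x ≡ punchIn v (path g (suc j)))
    lift (g , j , inj₁ (p , q)) = g , j , inj₁ (cong (punchIn v) p , cong (punchIn v) q)
    lift (g , j , inj₂ (p , q)) = g , j , inj₂ (cong (punchIn v) p , cong (punchIn v) q)

  extend-colouring : degree G v ≤ 2 → ThreeColorable (G - v) → ThreeColorable G
  extend-colouring small (g , proper) = colour , colour-proper
    where
    open Walks G using (_~_; ~-sym; ~-irrefl)

    partial : Fin (suc n) → Fin 3
    partial w with v Fin.≟ w
    -- A placeholder colour for `v`: `fresh` has to avoid only the colours of neighbours of `v`, and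
    -- `v` is not among them.
    ... | yes _ = 0F
    ... | no v≢w = g (punchOut v≢w)

    fresh : Fin 3
    fresh = proj₁ (free-colour G v small partial)

    colour : Fin (suc n) → Fin 3
    colour w with v Fin.≟ w
    ... | yes _ = fresh
    ... | no v≢w = g (punchOut v≢w)

    colour-new : colour v ≡ fresh
    colour-new with v Fin.≟ v
    ... | yes _ = refl
    ... | no v≢v = contradiction refl v≢v

    colour-old : ∀ {w} → v ≢ w → colour w ≡ partial w
    colour-old {w} v≢w with v Fin.≟ w
    ... | yes v≡w = contradiction v≡w v≢w
    ... | no _ = refl

    new-proper : ∀ {w} → v ~ w → colour v ≢ colour w
    new-proper v~w eq = proj₂ (free-colour G v small partial) v~w
      (trans (sym colour-new) (trans eq (colour-old λ { refl → ~-irrefl v~w })))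

    old-proper : ∀ u w → v ≢ u → v ≢ w → u ~ w → colour u ≢ colour w
    old-proper u w v≢u v≢w u~w with v Fin.≟ u | v Fin.≟ w
    ... | yes v≡u | _ = contradiction v≡u v≢u
    ... | no _ | yes v≡w = contradiction v≡w v≢w
    ... | no p | no q = proper (punchOut p) (punchOut q)
      (subst₂ _~_ (sym (Fin.punchIn-punchOut p)) (sym (Fin.punchIn-punchOut q)) u~w)

    colour-proper : ∀ u w → u ~ w → colour u ≢ colour w
    colour-proper u w u~w = by-cases (v Fin.≟ u) (v Fin.≟ w)
      where
      by-cases : Dec (v ≡ u) → Dec (v ≡ w) → colour u ≢ colour w
      by-cases (yes refl) _ = new-proper u~w
      by-cases (no _) (yes refl) = new-proper (~-sym u~w) ∘ sym
      by-cases (no v≢u) (no v≢w) = old-proper u w v≢u v≢w u~w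

three-colorable : ∀ n (G : Graph n) → ISK4-free G → GirthAtLeast G 5 → ThreeColorable G
three-colorable zero G _ _ = (λ ()) , λ ()
three-colorable (suc n) G free girth =
  let (v , small) = low-degree G free girth zero
  in extend-colouring G v small
       (three-colorable n (G - v) (free ∘ deletion-isk4 G v) (girth ∘ deletion-cycle G v))

theorem5p5 : (n : ℕ) (G : Graph (suc n)) → ISK4-free G → GirthAtLeast G 5 →
    Σ (Fin (suc n)) (λ v → degree G v ≤ 2) × ThreeColorable G
theorem5p5 n G free girth = low-degree G free girth zero , three-colorable (suc n) G free girth
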